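{- Let $k\le n$ be positive integers. Then $\textsc{bm}(k,n,n)\ge\min(k,\lceil n/2\rceil)$; that is, every $(k,n,n)$-fractionally balanced tripartite hypergraph has a matching of size $\min(k,\lceil n/2\rceil)$.
   Context: A hypergraph is identified with its finite edge set; a matching is a set of pairwise disjoint edges. A hypergraph $H$ is $k$-partite with sides $V_1,\ldots,V_k$ (a fixed partition of its vertex set) if $|e\cap V_t|=1$ for every edge $e$ and every $t$. For $f:H\to\mathbb{R}_{\ge0}$, $\deg_f(v)=\sum_{e\ni v}f(e)$; $f$ is balanced if $\deg_f$ is constant on each side. $H$ is $(b_1,\ldots,b_k)$-fractionally balanced if it is $k$-partite with sides of sizes $b_1,\ldots,b_k$ and has a nonzero balanced $f:H\to\mathbb{R}_{\ge0}$. $\textsc{bm}(b_1,\ldots,b_k)$ is the largest $m$ such that every $(b_1,\ldots,b_k)$-fractionally balanced $k$-partite hypergraph has a matching of size $m$.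
   Formalization: The balanced weight function f on H takes nonnegative rational values instead of nonnegative real ones; since balancedness is a finite linear system with integer coefficients, a nonzero real solution exists exactly when a rational one does. -}

module Defs where

open import Data.Nat using (ℕ; zero; suc)
open import Data.Fin using (Fin; zero; suc)
open import Data.Bool using (Bool; true; false)
open import Data.Rational using (ℚ; 0ℚ; _+_; _≤_)
open import Data.Product using (Σ; _×_; _,_; ∃)
open import Relation.Binary.PropositionalEquality using (_≡_; _≢_)

∑ : (n : ℕ) → (Fin n → ℚ) → ℚ
∑ zero    g = 0ℚ
∑ (suc n) g = g zero + ∑ n (λ i → g (suc i))

-- A tripartite hypergraph with sides V₁ = Fin a, V₂ = Fin b, V₃ = Fin c.
-- Every edge meets each side in exactly one vertex, so an edge is a triple
-- (x , y , z) ∈ V₁ × V₂ × V₃, and the (finite) edge set is a subset of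
-- V₁ × V₂ × V₃, given by its characteristic function.
Hypergraph3 : ℕ → ℕ → ℕ → Set
Hypergraph3 a b c = Fin a → Fin b → Fin c → Bool

_∋₃_ : ∀ {a b c} → Hypergraph3 a b c → Fin a × Fin b × Fin c → Set
H ∋₃ (x , y , z) = H x y z ≡ true

-- A weight function f : H → ℚ≥0, represented as a function on all triples
-- that vanishes outside the edge set.
Weight : ℕ → ℕ → ℕ → Set
Weight a b c = Fin a → Fin b → Fin c → ℚ

deg₁ : ∀ {a b c} → Weight a b c → Fin a → ℚ
deg₁ {a} {b} {c} f x = ∑ b (λ y → ∑ c (λ z → f x y z))

deg₂ : ∀ {a b c} → Weight a b c → Fin b → ℚ
deg₂ {a} {b} {c} f y = ∑ a (λ x → ∑ c (λ z → f x y z))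

deg₃ : ∀ {a b c} → Weight a b c → Fin c → ℚ
deg₃ {a} {b} {c} f z = ∑ a (λ x → ∑ b (λ y → f x y z))

IsWeighting : ∀ {a b c} → Hypergraph3 a b c → Weight a b c → Set
IsWeighting H f =
  (∀ x y z → 0ℚ ≤ f x y z) × (∀ x y z → H x y z ≡ false → f x y z ≡ 0ℚ)

Balanced : ∀ {a b c} → Weight a b c → Set
Balanced f =
  (∀ x x' → deg₁ f x ≡ deg₁ f x') ×
  (∀ y y' → deg₂ f y ≡ deg₂ f y') ×
  (∀ z z' → deg₃ f z ≡ deg₃ f z')

NonZeroWeight : ∀ {a b c} → Weight a b c → Set
NonZeroWeight f = ∃ λ x → ∃ λ y → ∃ λ z → f x y z ≢ 0ℚ

FractionallyBalanced : ∀ {a b c} → Hypergraph3 a b c → Set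
FractionallyBalanced {a} {b} {c} H =
  Σ (Weight a b c) λ f → IsWeighting H f × Balanced f × NonZeroWeight f

-- Two edges are disjoint iff they differ in every coordinate
-- (they can only share a vertex within the same side).
Disjoint₃ : ∀ {a b c} → Fin a × Fin b × Fin c → Fin a × Fin b × Fin c → Set
Disjoint₃ (x , y , z) (x' , y' , z') = x ≢ x' × y ≢ y' × z ≢ z'

HasMatchingOfSize : ∀ {a b c} → Hypergraph3 a b c → ℕ → Set
HasMatchingOfSize {a} {b} {c} H m =
  Σ (Fin m → Fin a × Fin b × Fin c) λ M →
    (∀ i → H ∋₃ M i) × (∀ i j → i ≢ j → Disjoint₃ (M i) (M j))

{-# OPTIONS --safe #-}

-- View the edges of H as the vertices of a graph in which two of them are adjacent when
-- they share a vertex of V₂ or V₃, and colour them by their V₁-coordinate: a matching is an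
-- independent set with distinct colours.  By the topological Hall theorem a rainbow
-- independent set exists as soon as, for every set I of colours, the independence complex
-- of the classes in I is acyclic over F₂ below dimension |I| - 1, and this follows
-- from an independent set M_I that is not dominated by fewer than |I| vertices.
-- Here M_I is a matching of the bipartite link of I: balancedness forces every vertex cover
-- of the link to have size at least |I| n / k, so by König M_I has size about 2|I|, whereas
-- an edge meets at most two edges of M_I.  König's theorem is itself an instance
-- of the same Hall theorem, with rows as colours and equality of columns as adjacency.
module Submission where

open import Defs
open import Data.Nat using (ℕ; _≤_; _⊓_; ⌈_/2⌉)

open import Algebra.Bundles using (CommutativeMonoid)
import Algebra.Properties.CommutativeMonoid.Mult as Mult
open import Algebra.Properties.CommutativeSemigroup using () renaming (interchange to +-interchange)
open import Data.Bool as Bool using (Bool; true; false; _∧_; _xor_; not)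
open import Data.Bool.Properties using (xor-same; xor-identityʳ; xor-comm; ∧-zeroʳ)
open import Data.Bool.Solver using (module xor-∧-Solver)
open import Data.Empty using (⊥; ⊥-elim)
open import Data.Fin as Fin using (Fin; zero; suc; lift; inject≤)
import Data.Fin.Properties as Fin
open import Data.Fin.Subset using (Subset; ∣_∣; ∁) renaming (⊤ to full; ⊥ to ∅)
open import Data.Fin.Subset.Properties using (∣⊥∣≡0; ∣p∣≤n; ∣∁p∣≡n∸∣p∣)
open import Data.List as List using (List; []; _∷_; length; allFin)
open import Data.List.Membership.Propositional using (_∈_)
open import Data.List.Membership.Propositional.Properties using (∈-allFin; ∈-map⁺)
import Data.List.Membership.DecPropositional as DecMembership
open import Data.List.Properties using (length-map)
open import Data.List.Relation.Unary.All as All using (All; []; _∷_)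
open import Data.List.Relation.Unary.All.Properties using () renaming (map⁻ to All-map⁻)
open import Data.List.Relation.Unary.Any using (here; there; index)
open import Data.List.Relation.Unary.Any.Properties using (lookup-index)
open import Data.Nat using (zero; suc; _+_; _*_; _∸_; _<_; z≤n; s≤s; s<s; z<s; s<s⁻¹; NonZero; ⌊_/2⌋)
import Data.Nat.Properties as ℕ
open import Data.Nat.Tactic.RingSolver using (solve-∀)
open import Data.Product using (Σ; ∃; ∃₂; _×_; _,_; proj₁; proj₂)
open import Data.Product.Function.NonDependent.Propositional using (_×-↔_)
open import Data.Product.Properties using (≡-dec)
open import Data.Rational as ℚ using (ℚ; 0ℚ)
import Data.Rational.Properties as ℚ
open import Data.Sum as Sum using (_⊎_; inj₁; inj₂; [_,_]′)
open import Data.Sum.Function.Propositional using (_⊎-↔_)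
open import Data.Sum.Properties using (inj₁-injective; inj₂-injective)
open import Data.Unit using (⊤; tt)
open import Data.Vec using ([]; _∷_; lookup; _[_]≔_)
open import Data.Vec.Properties using (lookup∘update; lookup∘update′; lookup-replicate; lookup-map)
open import Function using (_∘_; _↔_; Inverse)
open import Function.Construct.Composition using (_↔-∘_)
open import Function.Construct.Identity using (↔-id)
open import Function.Definitions using (Injective)
open import Level using (0ℓ)
open import Relation.Binary using (tri<; tri≈; tri>)
open import Relation.Binary.PropositionalEquality
open import Relation.Nullary using (¬_; Dec; yes; no; contradiction)
open import Relation.Nullary.Decidable using (¬?; _×-dec_; _⊎-dec_; decidable-stable)
open import Relation.Unary using (Pred; Decidable)

open Mult ℚ.+-0-commutativeMonoid using (×-homo-+; ×-assocˡ) renaming (_×_ to _·_)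

private variable
  n k : ℕ

-- Subsets and Boolean arithmetic.

_∋_ : Subset n → Fin n → Set
σ ∋ v = lookup σ v ≡ true

_⊑_ : Subset n → Subset n → Set
σ ⊑ τ = ∀ v → σ ∋ v → τ ∋ v

true≢false : ∀ {b} → b ≡ true → b ≡ false → ⊥
true≢false refl ()

¬true⇒false : ∀ {b} → ¬ b ≡ true → b ≡ false
¬true⇒false {false} _ = refl
¬true⇒false {true}  h = contradiction refl h

xor-true : ∀ a {b} → a xor b ≡ true → a ≡ true ⊎ b ≡ true
xor-true true  _ = inj₁ refl
xor-true false h = inj₂ h

∧-true : ∀ a {b} → a ∧ b ≡ true → a ≡ true × b ≡ true
∧-true true h = refl , h

-- Mod 2 chains

Chain : ℕ → Set
Chain n = Subset n → Bool

infixl 6 _⊕_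
_⊕_ : Chain n → Chain n → Chain n
(f ⊕ g) σ = f σ xor g σ

-- The coefficient at `σ` is the sum of `f` over all sets with one vertex more than `σ`. The empty
-- set counts as a face, so the complex is augmented.
∂ : Chain n → Chain n
∂ f []          = false
∂ f (true ∷ σ)  = ∂ (f ∘ (true ∷_)) σ
∂ f (false ∷ σ) = f (true ∷ σ) xor ∂ (f ∘ (false ∷_)) σ

-- The coboundary, applied in the index of a family c of chains: the condition
-- ∂ (c I) = Σ_{i ∈ I} c (I - i) reads ∂ (c I) σ ≡ δ (λ J → c J σ) I.
δ : Chain n → Chain n
δ f []          = false
δ f (true ∷ σ)  = f (false ∷ σ) xor δ (f ∘ (true ∷_)) σ
δ f (false ∷ σ) = δ (f ∘ (false ∷_)) σ

∂-0 : (σ : Subset n) → ∂ (λ _ → false) σ ≡ false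
∂-0 []          = refl
∂-0 (true ∷ σ)  = ∂-0 σ
∂-0 (false ∷ σ) = ∂-0 σ

interchange : ∀ a b c d → (a xor b) xor (c xor d) ≡ (a xor c) xor (b xor d)
interchange = solve 4 (λ a b c d → (a :+ b) :+ (c :+ d) := (a :+ c) :+ (b :+ d)) refl
  where open xor-∧-Solver

∂-⊕ : (f g : Chain n) → ∂ (f ⊕ g) ≗ ∂ f ⊕ ∂ g
∂-⊕ f g []          = refl
∂-⊕ f g (true ∷ σ)  = ∂-⊕ (f ∘ (true ∷_)) (g ∘ (true ∷_)) σ
∂-⊕ f g (false ∷ σ) = trans
  (cong ((f (true ∷ σ) xor g (true ∷ σ)) xor_) (∂-⊕ (f ∘ (false ∷_)) (g ∘ (false ∷_)) σ))
  (interchange (f (true ∷ σ)) _ _ _)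

δ-cong : {f g : Chain n} (σ : Subset n) →
  (∀ τ → ∣ τ ∣ < ∣ σ ∣ → f τ ≡ g τ) → δ f σ ≡ δ g σ
δ-cong []          h = refl
δ-cong (true ∷ σ)  h =
  cong₂ _xor_ (h (false ∷ σ) ℕ.≤-refl) (δ-cong σ (λ τ lt → h (true ∷ τ) (s<s lt)))
δ-cong (false ∷ σ) h = δ-cong σ (λ τ lt → h (false ∷ τ) lt)

δ-⊕ : (f g : Chain n) → δ (f ⊕ g) ≗ δ f ⊕ δ g
δ-⊕ f g []          = refl
δ-⊕ f g (false ∷ σ) = δ-⊕ (f ∘ (false ∷_)) (g ∘ (false ∷_)) σ
δ-⊕ f g (true ∷ σ)  = trans
  (cong ((f (false ∷ σ) xor g (false ∷ σ)) xor_) (δ-⊕ (f ∘ (true ∷_)) (g ∘ (true ∷_)) σ))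
  (interchange (f (false ∷ σ)) _ _ _)

δ-δ : (f : Chain n) (σ : Subset n) → δ (δ f) σ ≡ false
δ-δ f []          = refl
δ-δ f (false ∷ σ) = δ-δ (f ∘ (false ∷_)) σ
δ-δ f (true ∷ σ)
  rewrite δ-⊕ (f ∘ (false ∷_)) (δ (f ∘ (true ∷_))) σ
        | δ-δ (f ∘ (true ∷_)) σ
        | xor-identityʳ (δ (f ∘ (false ∷_)) σ)
        = xor-same (δ (f ∘ (false ∷_)) σ)

-- The two operators act on different variables, so they commute by linearity of `∂`.
∂-δ : (c : Subset k → Chain n) (I : Subset k) (σ : Subset n) →
  ∂ (λ τ → δ (λ J → c J τ) I) σ ≡ δ (λ J → ∂ (c J) σ) I
∂-δ c []          σ = ∂-0 σ
∂-δ c (false ∷ I) σ = ∂-δ (c ∘ (false ∷_)) I σ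
∂-δ c (true ∷ I)  σ = trans
  (∂-⊕ (c (false ∷ I)) (λ τ → δ (λ J → c (true ∷ J) τ) I) σ)
  (cong (∂ (c (false ∷ I)) σ xor_) (∂-δ (c ∘ (true ∷_)) I σ))

δ-support : (f : Chain n) (σ : Subset n) → δ f σ ≡ true →
  ∃ λ τ → f τ ≡ true × ∣ τ ∣ < ∣ σ ∣ × τ ⊑ σ
δ-support f (false ∷ σ) h with δ-support (f ∘ (false ∷_)) σ h
... | τ , p , q , r = false ∷ τ , p , q , λ { (suc v) → r v }
δ-support f (true ∷ σ)  h with xor-true (f (false ∷ σ)) h
... | inj₁ p = false ∷ σ , p , ℕ.≤-refl , λ { (suc v) e → e }
... | inj₂ p with δ-support (f ∘ (true ∷_)) σ p
...   | τ , p , q , r = true ∷ τ , p , s<s q , λ { zero _ → refl ; (suc v) → r v }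

-- In the exterior algebra over F₂ on the vertices, `wedge e` is multiplication by `e`, which kills
-- faces through `e`, and `link e` is contraction by `e`.
del link wedge : Fin n → Chain n → Chain n
del   e z σ = not (lookup σ e) ∧ z σ
link  e z σ = not (lookup σ e) ∧ z (σ [ e ]≔ true)
wedge e z σ = lookup σ e ∧ z (σ [ e ]≔ false)

del-wedge-link : (e : Fin n) (z : Chain n) → z ≗ del e z ⊕ wedge e (link e z)
del-wedge-link zero    z (true ∷ σ)  = refl
del-wedge-link zero    z (false ∷ σ) = sym (xor-identityʳ _)
del-wedge-link (suc e) z (b ∷ σ)     = del-wedge-link e (z ∘ (b ∷_)) σ

∧-distribˡ-xor : ∀ a b c → a ∧ (b xor c) ≡ (a ∧ b) xor (a ∧ c)
∧-distribˡ-xor true  b c = refl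
∧-distribˡ-xor false b c = refl

xor-cancelˡ : ∀ a b → a xor (a xor b) ≡ b
xor-cancelˡ true  true  = refl
xor-cancelˡ true  false = refl
xor-cancelˡ false b     = refl

xor-swap : ∀ a b c → a xor (b xor c) ≡ b xor (a xor c)
xor-swap = solve 3 (λ a b c → a :+ (b :+ c) := b :+ (a :+ c)) refl
  where open xor-∧-Solver

wedge-cong : (e : Fin n) {f g : Chain n} → f ≗ g → wedge e f ≗ wedge e g
wedge-cong e h σ = cong (lookup σ e ∧_) (h _)

-- The Leibniz rule without signs, with `∂ e = 1`. In particular the cone `wedge e z` bounds `z`
-- when `z` is a cycle.
∂-wedge : (e : Fin n) (z : Chain n) → ∂ (wedge e z) ≗ z ⊕ wedge e (∂ z)
∂-wedge zero    z (true ∷ σ)  = sym (xor-cancelˡ (z (true ∷ σ)) _)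
∂-wedge zero    z (false ∷ σ) = cong (z (false ∷ σ) xor_) (∂-0 σ)
∂-wedge (suc e) z (true ∷ σ)  = ∂-wedge e (z ∘ (true ∷_)) σ
∂-wedge (suc e) z (false ∷ σ)
  rewrite ∂-wedge e (z ∘ (false ∷_)) σ
        | ∧-distribˡ-xor (lookup σ e) (z (true ∷ (σ [ e ]≔ false))) (∂ (z ∘ (false ∷_)) (σ [ e ]≔ false))
        = xor-swap (lookup σ e ∧ z (true ∷ (σ [ e ]≔ false))) (z (false ∷ σ)) _

∂-link : (e : Fin n) (z : Chain n) → ∂ (link e z) ≗ link e (∂ z)
∂-link zero    z (true ∷ σ)  = ∂-0 σ
∂-link zero    z (false ∷ σ) = refl
∂-link (suc e) z (true ∷ σ)  = ∂-link e (z ∘ (true ∷_)) σ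
∂-link (suc e) z (false ∷ σ)
  rewrite ∂-link e (z ∘ (false ∷_)) σ
        = sym (∧-distribˡ-xor (not (lookup σ e)) _ _)

-- A face of `∂ z` avoiding `e` arises from a face of `z` that avoids `e`, or by removing `e`
-- itself; the latter gives `link e z`.
∂-del : (e : Fin n) (z : Chain n) → del e (∂ z) ≗ ∂ (del e z) ⊕ link e z
∂-del zero    z (true ∷ σ)  = sym (trans (xor-identityʳ _) (∂-0 σ))
∂-del zero    z (false ∷ σ) = xor-comm (z (true ∷ σ)) _
∂-del (suc e) z (true ∷ σ)  = ∂-del e (z ∘ (true ∷_)) σ
∂-del (suc e) z (false ∷ σ)
  rewrite ∧-distribˡ-xor (not (lookup σ e)) (z (true ∷ σ)) (∂ (z ∘ (false ∷_)) σ)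
        | ∂-del e (z ∘ (false ∷_)) σ
        = assoc (not (lookup σ e) ∧ z (true ∷ σ)) _ _
  where
  open xor-∧-Solver
  assoc : ∀ a b c → a xor (b xor c) ≡ (a xor b) xor c
  assoc = solve 3 (λ a b c → a :+ (b :+ c) := (a :+ b) :+ c) refl

-- Push-forward of chains along a colouring

ε : Chain k
ε []          = true
ε (true ∷ _)  = false
ε (false ∷ I) = ε I

∂-ε : (I : Subset k) → ∂ ε I ≡ false
∂-ε []          = refl
∂-ε (true ∷ I)  = ∂-0 I
∂-ε (false ∷ I) = ∂-ε I

ε-∅ : ε (∅ {k}) ≡ true
ε-∅ {zero}  = refl
ε-∅ {suc k} = ε-∅ {k}

ε-empty : (I : Subset k) → ε I ≡ true → ∀ i → ¬ I ∋ i
ε-empty (false ∷ I) h (suc i) = ε-empty I h i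

ε-size : (I : Subset k) → ε I ≡ true → ∣ I ∣ ≡ 0
ε-size []          _ = refl
ε-size (false ∷ I) h = ε-size I h

-- Chains are elements of an exterior algebra over F₂ and ρ is the algebra map induced by the
-- colouring, so it sends simplices with a repeated colour to 0.
ρ : (Fin n → Fin k) → Chain n → Chain k
ρ {zero}  col z I = z [] ∧ ε I
ρ {suc n} col z =
  ρ (col ∘ suc) (z ∘ (false ∷_)) ⊕ wedge (col zero) (ρ (col ∘ suc) (z ∘ (true ∷_)))

ρ-cong : (col : Fin n → Fin k) {f g : Chain n} → f ≗ g → ρ col f ≗ ρ col g
ρ-cong {zero}  col h I = cong (_∧ ε I) (h [])
ρ-cong {suc n} col h I = cong₂ _xor_
  (ρ-cong (col ∘ suc) (h ∘ (false ∷_)) I)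
  (wedge-cong (col zero) (ρ-cong (col ∘ suc) (h ∘ (true ∷_))) I)

ρ-⊕ : (col : Fin n → Fin k) (f g : Chain n) → ρ col (f ⊕ g) ≗ ρ col f ⊕ ρ col g
ρ-⊕ {zero} col f g I = distribʳ (f []) (g []) (ε I)
  where
  open xor-∧-Solver
  distribʳ : ∀ a b c → (a xor b) ∧ c ≡ (a ∧ c) xor (b ∧ c)
  distribʳ = solve 3 (λ a b c → (a :+ b) :* c := (a :* c) :+ (b :* c)) refl
ρ-⊕ {suc n} col f g I
  rewrite ρ-⊕ (col ∘ suc) (f ∘ (false ∷_)) (g ∘ (false ∷_)) I
        | ρ-⊕ (col ∘ suc) (f ∘ (true ∷_)) (g ∘ (true ∷_)) (I [ col zero ]≔ false)
        | ∧-distribˡ-xor (lookup I (col zero))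
            (ρ (col ∘ suc) (f ∘ (true ∷_)) (I [ col zero ]≔ false))
            (ρ (col ∘ suc) (g ∘ (true ∷_)) (I [ col zero ]≔ false))
        = interchange (ρ (col ∘ suc) (f ∘ (false ∷_)) I) _ _ _

ρ-0 : (col : Fin n → Fin k) (I : Subset k) → ρ col (λ _ → false) I ≡ false
ρ-0 {zero}  col I = refl
ρ-0 {suc n} col I
  rewrite ρ-0 (col ∘ suc) I | ρ-0 (col ∘ suc) (I [ col zero ]≔ false)
        = ∧-zeroʳ (lookup I (col zero))

ρ-δ : (col : Fin n → Fin k) {l : ℕ} (c : Subset l → Chain n) (I : Subset l) (J : Subset k) →
  ρ col (λ σ → δ (λ K → c K σ) I) J ≡ δ (λ K → ρ col (c K) J) I
ρ-δ col c []          J = ρ-0 col J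
ρ-δ col c (false ∷ I) J = ρ-δ col (c ∘ (false ∷_)) I J
ρ-δ col c (true ∷ I)  J = trans
  (ρ-⊕ col (c (false ∷ I)) (λ σ → δ (λ K → c (true ∷ K) σ) I) J)
  (cong (ρ col (c (false ∷ I)) J xor_) (ρ-δ col (c ∘ (true ∷_)) I J))

-- On both sides `∂` is the derivation that sends every vertex to 1, and `ρ` sends vertices to
-- vertices; the inductive step is `∂-wedge`.
ρ-∂ : (col : Fin n → Fin k) (z : Chain n) → ρ col (∂ z) ≗ ∂ (ρ col z)
ρ-∂ {zero} col z I with z []
... | true  = sym (∂-ε I)
... | false = sym (∂-0 I)
ρ-∂ {suc n} col z I
  rewrite ρ-⊕ (col ∘ suc) (z ∘ (true ∷_)) (∂ (z ∘ (false ∷_))) I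
        | ∂-⊕ (ρ (col ∘ suc) (z ∘ (false ∷_)))
              (wedge (col zero) (ρ (col ∘ suc) (z ∘ (true ∷_)))) I
        | ∂-wedge (col zero) (ρ (col ∘ suc) (z ∘ (true ∷_))) I
        | ρ-∂ (col ∘ suc) (z ∘ (false ∷_)) I
        | ρ-∂ (col ∘ suc) (z ∘ (true ∷_)) (I [ col zero ]≔ false)
        = rearrange (ρ (col ∘ suc) (z ∘ (true ∷_)) I) _ _
  where
  open xor-∧-Solver
  rearrange : ∀ a b c → (a xor b) xor c ≡ b xor (a xor c)
  rearrange = solve 3 (λ a b c → (a :+ b) :+ c := b :+ (a :+ c)) refl

-- Cancellation mod 2 only loses terms, so an odd coefficient always comes from some face of `z`.
-- This is how parity produces a rainbow set.
ρ-support : (col : Fin n → Fin k) (z : Chain n) (J : Subset k) → ρ col z J ≡ true →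
  ∃ λ σ → z σ ≡ true × (∀ i → J ∋ i → ∃ λ v → σ ∋ v × col v ≡ i)
ρ-support {zero} col z J h with ∧-true (z []) h
... | p , q = [] , p , λ i J∋i → contradiction J∋i (ε-empty J q i)
ρ-support {suc n} col z J h with xor-true (ρ (col ∘ suc) (z ∘ (false ∷_)) J) h
... | inj₁ p with ρ-support (col ∘ suc) (z ∘ (false ∷_)) J p
...   | σ , q , r = false ∷ σ , q , λ i J∋i → let v , s , t = r i J∋i in suc v , s , t
ρ-support {suc n} col z J h | inj₂ p with ∧-true (lookup J (col zero)) p
... | _ , q with ρ-support (col ∘ suc) (z ∘ (true ∷_)) (J [ col zero ]≔ false) q
...   | σ , r , s = true ∷ σ , r , rainbow
  where
  rainbow : ∀ i → J ∋ i → ∃ λ v → (true ∷ σ) ∋ v × col v ≡ i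
  rainbow i J∋i with i Fin.≟ col zero
  ... | yes i≡ = zero , refl , sym i≡
  ... | no  i≢ with s i (trans (lookup∘update′ i≢ J false) J∋i)
  ...   | v , t , u = suc v , t , u

ρ-ε : (col : Fin n → Fin k) → ρ col ε ∅ ≡ true
ρ-ε {zero} {k} col = ε-∅ {k}
ρ-ε {suc n} {k} col
  rewrite lookup-replicate (col zero) false | ρ-ε (col ∘ suc) = refl

-- Here and in `δ-vanishes` the operator reads only sets that the support condition excludes: those
-- with one element more than `I`, respectively one less.
∂-vanishes : (f : Chain k) (I : Subset k) → (∀ J → f J ≡ true → J ⊑ I) → ∂ f I ≡ false
∂-vanishes f []          h = refl
∂-vanishes f (true ∷ I)  h = ∂-vanishes (f ∘ (true ∷_)) I (λ J p v → h (true ∷ J) p (suc v))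
∂-vanishes f (false ∷ I) h
  rewrite ∂-vanishes (f ∘ (false ∷_)) I (λ J p v → h (false ∷ J) p (suc v))
        | ¬true⇒false {f (true ∷ I)} (λ p → true≢false (h (true ∷ I) p zero refl) refl) = refl

δ-vanishes : (f : Chain k) (I : Subset k) → (∀ J → f J ≡ true → I ⊑ J) → δ f I ≡ false
δ-vanishes f []          h = refl
δ-vanishes f (false ∷ I) h = δ-vanishes (f ∘ (false ∷_)) I (λ J p v → h (false ∷ J) p (suc v))
δ-vanishes f (true ∷ I)  h
  rewrite δ-vanishes (f ∘ (true ∷_)) I (λ J p v → h (true ∷ J) p (suc v))
        | ¬true⇒false {f (false ∷ I)} (λ p → true≢false (h (false ∷ I) p zero refl) refl) = refl

-- The parity argument of Sperner's lemma.
diagonal : (F : Subset k → Chain k) →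
  (∀ I J → F I J ≡ true → J ⊑ I) →
  (∀ I J → ∂ (F I) J ≡ δ (λ K → F K J) I) →
  F ∅ ∅ ≡ true → ∀ I → F I I ≡ true
diagonal F supp eq unit [] = unit
diagonal {suc k} F supp eq unit = λ where
    (false ∷ I) → smaller I
    (true ∷ I)  → trans (step I) (smaller I)
  where
  smaller : ∀ I → F (false ∷ I) (false ∷ I) ≡ true
  smaller = diagonal (λ I J → F (false ∷ I) (false ∷ J))
    (λ I J p v → supp (false ∷ I) (false ∷ J) p (suc v))
    (λ I J → trans
      (cong (_xor ∂ (λ K → F (false ∷ I) (false ∷ K)) J)
        (sym (¬true⇒false {F (false ∷ I) (true ∷ J)}
          (λ p → true≢false (supp (false ∷ I) (true ∷ J) p zero refl) refl))))
      (eq (false ∷ I) (false ∷ J)))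
    unit
  -- The boundary equation for `true ∷ I` is read at its facet `false ∷ I`; the support condition
  -- leaves a single term on each side.
  step : ∀ I → F (true ∷ I) (true ∷ I) ≡ F (false ∷ I) (false ∷ I)
  step I = begin
    F (true ∷ I) (true ∷ I)
      ≡⟨ xor-identityʳ _ ⟨
    F (true ∷ I) (true ∷ I) xor false
      ≡⟨ cong (F (true ∷ I) (true ∷ I) xor_)
           (∂-vanishes (λ J → F (true ∷ I) (false ∷ J)) I
             (λ J p v → supp (true ∷ I) (false ∷ J) p (suc v))) ⟨
    ∂ (F (true ∷ I)) (false ∷ I)
      ≡⟨ eq (true ∷ I) (false ∷ I) ⟩
    δ (λ K → F K (false ∷ I)) (true ∷ I)
      ≡⟨ cong (F (false ∷ I) (false ∷ I) xor_)
           (δ-vanishes (λ J → F (true ∷ J) (false ∷ I)) I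
             (λ J p v → supp (true ∷ J) (false ∷ I) p (suc v))) ⟩
    F (false ∷ I) (false ∷ I) xor false
      ≡⟨ xor-identityʳ _ ⟩
    F (false ∷ I) (false ∷ I) ∎
    where open ≡-Reasoning

-- Independence complexes

size-insert : (σ : Subset n) (e : Fin n) → lookup σ e ≡ false →
  ∣ σ [ e ]≔ true ∣ ≡ suc ∣ σ ∣
size-insert (false ∷ σ) zero    _ = refl
size-insert (true ∷ σ)  (suc e) h = cong suc (size-insert σ e h)
size-insert (false ∷ σ) (suc e) h = size-insert σ e h

size-remove : (σ : Subset n) (e : Fin n) → σ ∋ e → ∣ σ ∣ ≡ suc ∣ σ [ e ]≔ false ∣
size-remove (true ∷ σ)  zero    _ = refl
size-remove (true ∷ σ)  (suc e) h = cong suc (size-remove σ e h)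
size-remove (false ∷ σ) (suc e) h = size-remove σ e h

-- The adjacency relations of the applications are reflexive, so equal vertices have to be exempt.
Independent : {V : Set} → (V → V → Set) → Pred V 0ℓ → Set
Independent _~_ P = ∀ u v → P u → P v → u ≢ v → ¬ u ~ v

Undominated : {V : Set} → (V → V → Set) → Pred V 0ℓ → ℕ → Set
Undominated _~_ M m = ∀ es → length es < m → ∃ λ w → M w × All (λ e → ¬ e ~ w) es

-- A certificate for the Hall condition at `I`. The bound `m` is kept apart from `∣ I ∣` for the
-- deficiency version, where it is `∣ I ∣ ∸ d`.
HallSet : {V : Set} → (V → V → Set) → (V → Fin k) → Pred V 0ℓ → Subset k → ℕ → Set₁
HallSet {V = V} _~_ col A I m = Σ (Pred V 0ℓ) λ M → Decidable M ×
  (∀ {v} → M v → A v × I ∋ col v) × Independent _~_ M × Undominated _~_ M m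

module IndependenceComplex {N : ℕ} (_~_ : Fin N → Fin N → Set)
  (~-sym : ∀ {u v} → u ~ v → v ~ u) (_~?_ : ∀ u v → Dec (u ~ v)) where

  Face : Pred (Fin N) 0ℓ → ℕ → Subset N → Set
  Face S m σ = ∣ σ ∣ < m × (∀ v → σ ∋ v → S v) × Independent _~_ (σ ∋_)

  On : Pred (Fin N) 0ℓ → ℕ → Chain N → Set
  On S m z = ∀ σ → z σ ≡ true → Face S m σ

  Bounds : Pred (Fin N) 0ℓ → ℕ → Chain N → Set
  Bounds S m z = ∃ λ c → On S (suc m) c × ∂ c ≗ z

  face-mono : ∀ {S T m l} σ → (∀ {v} → S v → T v) → m ≤ l → Face S m σ → Face T l σ
  face-mono σ ST m≤l (a , b , c) = ℕ.<-≤-trans a m≤l , (λ v p → ST (b v p)) , c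

  On-⊕ : ∀ {S m f g} → On S m f → On S m g → On S m (f ⊕ g)
  On-⊕ {f = f} p q σ h with xor-true (f σ) h
  ... | inj₁ x = p σ x
  ... | inj₂ y = q σ y

  On-del : ∀ {S m z} e → On S m z → On (λ v → S v × v ≢ e) m (del e z)
  On-del e p σ h with lookup σ e in eq
  ... | false = let a , b , c = p σ h in
        a , (λ v q → b v q , λ { refl → true≢false q eq }) , c

  On-link : ∀ {S m z} e → On S (suc m) z →
    On (λ v → S v × v ≢ e × ¬ e ~ v) m (link e z)
  On-link {S} {m} {z} e p σ h with lookup σ e in eq
  ... | false with p (σ [ e ]≔ true) h
  ...   | a , b , c =
        s<s⁻¹ (subst (_< suc m) (size-insert σ e eq) a)
      , (λ v q → b v (up q) , ≢e q , c e v (lookup∘update e σ true) (up q) (λ e≡v → ≢e q (sym e≡v)))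
      , (λ u v x y → c u v (up x) (up y))
    where
    ≢e : ∀ {v} → σ ∋ v → v ≢ e
    ≢e q refl = true≢false q eq
    up : ∀ {v} → σ ∋ v → (σ [ e ]≔ true) ∋ v
    up q = trans (lookup∘update′ (≢e q) σ true) q

  -- Non-adjacency to `e` is demanded only of vertices other than `e`, since faces of `z` through
  -- `e` do not survive in `wedge e z`.
  On-wedge : ∀ {S T m z} e → S e → (∀ {v} → T v → S v) →
    (∀ {v} → T v → v ≢ e → ¬ e ~ v) → On T m z → On S (suc m) (wedge e z)
  On-wedge {S} {m = m} e Se TS far p σ h with lookup σ e in eq
  ... | true with p (σ [ e ]≔ false) h
  ...   | a , b , c = subst (_< suc m) (sym (size-remove σ e eq)) (s<s a) , inS , indep
    where
    down : ∀ {v} → v ≢ e → σ ∋ v → (σ [ e ]≔ false) ∋ v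
    down v≢e q = trans (lookup∘update′ v≢e σ false) q
    inS : ∀ v → σ ∋ v → S v
    inS v q with v Fin.≟ e
    ... | yes refl = Se
    ... | no  v≢e  = TS (b v (down v≢e q))
    indep : Independent _~_ (σ ∋_)
    indep u v x y u≢v with u Fin.≟ e | v Fin.≟ e
    ... | yes refl | yes refl = contradiction refl u≢v
    ... | yes refl | no v≢e   = far (b v (down v≢e y)) v≢e
    ... | no u≢e   | yes refl = λ r → far (b u (down u≢e x)) u≢e (~-sym r)
    ... | no u≢e   | no v≢e   = c u v (down u≢e x) (down v≢e y) u≢v

  -- A vertex e outside M can be removed from a cycle z: the link of e in z is a cycle in the
  -- complex of non-neighbours of e, where M loses only the neighbours of e, so it bounds
  -- some c₁ by induction on m, and z is homologous to del e z + c₁.  When only vertices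
  -- of M are left the complex is a simplex.
  acyclic : ∀ m {S M : Pred (Fin N) 0ℓ} → Decidable S → Decidable M →
    (∀ {v} → M v → S v) → Independent _~_ M → Undominated _~_ M m →
    ∀ z → On S m z → (∀ σ → ∂ z σ ≡ false) → Bounds S m z
  acyclic zero _ _ _ _ _ z on _ =
    (λ _ → false) , (λ _ ()) , λ σ → trans (∂-0 σ) (sym (¬true⇒false (λ p → ℕ.n≮0 (proj₁ (on σ p)))))
  acyclic (suc m) {S₀} {M} S₀? M? M⊆S₀ indep undom z₀ on₀ cyc₀ =
    go (allFin N) S₀? M⊆S₀ (λ {v} _ → inj₂ (∈-allFin v)) z₀ on₀ cyc₀
    where
    go : ∀ es {S} → Decidable S → (∀ {v} → M v → S v) → (∀ {v} → S v → M v ⊎ v ∈ es) →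
      ∀ z → On S (suc m) z → (∀ σ → ∂ z σ ≡ false) → Bounds S (suc m) z
    -- The empty list does not dominate `M`, so `M` has a vertex `w`; by now `S` is contained in
    -- `M`, and the cone from `w` bounds `z`.
    go [] {S} S? M⊆S rest z on cyc with undom [] z<s
    ... | w , Mw , _ = wedge w z
        , On-wedge {S} {S} w (M⊆S Mw) (λ x → x)
            (λ {v} Sv v≢w → indep w v Mw (inM Sv) (λ w≡v → v≢w (sym w≡v))) on
        , λ σ → begin
            ∂ (wedge w z) σ                     ≡⟨ ∂-wedge w z σ ⟩
            z σ xor (lookup σ w ∧ ∂ z (σ [ w ]≔ false))
              ≡⟨ cong (λ b → z σ xor (lookup σ w ∧ b)) (cyc (σ [ w ]≔ false)) ⟩
            z σ xor (lookup σ w ∧ false)        ≡⟨ cong (z σ xor_) (∧-zeroʳ (lookup σ w)) ⟩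
            z σ xor false                       ≡⟨ xor-identityʳ (z σ) ⟩
            z σ                                 ∎
      where
      open ≡-Reasoning
      inM : ∀ {v} → S v → M v
      inM Sv with rest Sv
      ... | inj₁ Mv = Mv
    go (e ∷ es) {S} S? M⊆S rest z on cyc with M? e | S? e
    ... | yes Me | _ = go es S? M⊆S rest′ z on cyc
      where
      rest′ : ∀ {v} → S v → M v ⊎ v ∈ es
      rest′ Sv with rest Sv
      ... | inj₁ Mv           = inj₁ Mv
      ... | inj₂ (here refl)  = inj₁ Me
      ... | inj₂ (there v∈es) = inj₂ v∈es
    ... | no ¬Me | no ¬Se = go es S? M⊆S rest′ z on cyc
      where
      rest′ : ∀ {v} → S v → M v ⊎ v ∈ es
      rest′ Sv with rest Sv
      ... | inj₁ Mv           = inj₁ Mv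
      ... | inj₂ (here refl)  = contradiction Sv ¬Se
      ... | inj₂ (there v∈es) = inj₂ v∈es
    ... | no ¬Me | yes Se = c ⊕ wedge e c₁
        , On-⊕ {f = c} (λ σ p → face-mono σ proj₁ ℕ.≤-refl (onc σ p))
            (On-wedge {S} {S₁} e Se proj₁ (λ Tv _ → proj₂ (proj₂ Tv)) on₁)
        , bounds
      where
      S₁ M₁ S₂ : Pred (Fin N) 0ℓ
      S₁ v = S v × v ≢ e × ¬ e ~ v
      M₁ v = M v × ¬ e ~ v
      S₂ v = S v × v ≢ e
      ≢e : ∀ {v} → M v → v ≢ e
      ≢e Mv refl = ¬Me Mv
      filling : Bounds S₁ m (link e z)
      filling = acyclic m {S₁} {M₁}
        (λ v → S? v ×-dec ¬? (v Fin.≟ e) ×-dec ¬? (e ~? v))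
        (λ v → M? v ×-dec ¬? (e ~? v))
        (λ (Mv , far) → M⊆S Mv , ≢e Mv , far)
        (λ u v x y → indep u v (proj₁ x) (proj₁ y))
        -- If `fs` dominated what is left of `M`, then `e ∷ fs` would dominate `M`: the bound drops
        -- by one, as does the size of faces in the link.
        (λ fs lt → dominate (undom (e ∷ fs) (s<s lt)))
        (link e z) (On-link e on)
        (λ σ → trans (∂-link e z σ) (trans (cong (not (lookup σ e) ∧_) (cyc (σ [ e ]≔ true))) (∧-zeroʳ _)))
        where
        dominate : ∀ {fs} → (∃ λ w → M w × All (λ f → ¬ f ~ w) (e ∷ fs)) →
          ∃ λ w → M₁ w × All (λ f → ¬ f ~ w) fs
        dominate (w , Mw , far ∷ fars) = w , (Mw , far) , fars
      c₁ = proj₁ filling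
      on₁ = proj₁ (proj₂ filling)
      z₁ = del e z ⊕ c₁
      open ≡-Reasoning
      cyc₁ : ∀ σ → ∂ z₁ σ ≡ false
      cyc₁ σ = begin
        ∂ z₁ σ                         ≡⟨ ∂-⊕ (del e z) c₁ σ ⟩
        ∂ (del e z) σ xor ∂ c₁ σ       ≡⟨ cong (∂ (del e z) σ xor_) (proj₂ (proj₂ filling) σ) ⟩
        ∂ (del e z) σ xor link e z σ   ≡⟨ ∂-del e z σ ⟨
        del e (∂ z) σ                  ≡⟨ cong (not (lookup σ e) ∧_) (cyc σ) ⟩
        not (lookup σ e) ∧ false       ≡⟨ ∧-zeroʳ _ ⟩
        false                          ∎
      rest′ : ∀ {v} → S₂ v → M v ⊎ v ∈ es
      rest′ (Sv , v≢e) with rest Sv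
      ... | inj₁ Mv           = inj₁ Mv
      ... | inj₂ (here refl)  = contradiction refl v≢e
      ... | inj₂ (there v∈es) = inj₂ v∈es
      rec : Bounds S₂ (suc m) z₁
      rec = go es (λ v → S? v ×-dec ¬? (v Fin.≟ e)) (λ Mv → M⊆S Mv , ≢e Mv) rest′ z₁
        (On-⊕ {f = del e z} (On-del e on)
          (λ σ p → face-mono σ (λ (a , b , _) → a , b) ℕ.≤-refl (on₁ σ p)))
        cyc₁
      c = proj₁ rec
      onc = proj₁ (proj₂ rec)
      collapse : ∀ a b d → (a xor b) xor (b xor d) ≡ a xor d
      collapse = solve 3 (λ a b d → (a :+ b) :+ (b :+ d) := a :+ d) refl
        where open xor-∧-Solver
      -- `c` bounds `del e z ⊕ c₁`, and `wedge e c₁` bounds `c₁ ⊕ wedge e (link e z)`; the two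
      -- copies of `c₁` cancel.
      bounds : ∂ (c ⊕ wedge e c₁) ≗ z
      bounds σ = begin
        ∂ (c ⊕ wedge e c₁) σ                            ≡⟨ ∂-⊕ c (wedge e c₁) σ ⟩
        ∂ c σ xor ∂ (wedge e c₁) σ
          ≡⟨ cong₂ _xor_ (proj₂ (proj₂ rec) σ) (∂-wedge e c₁ σ) ⟩
        (del e z σ xor c₁ σ) xor (c₁ σ xor wedge e (∂ c₁) σ)
          ≡⟨ collapse (del e z σ) (c₁ σ) _ ⟩
        del e z σ xor wedge e (∂ c₁) σ
          ≡⟨ cong (del e z σ xor_) (wedge-cong e (proj₂ (proj₂ filling)) σ) ⟩
        del e z σ xor wedge e (link e z) σ              ≡⟨ del-wedge-link e z σ ⟨
        z σ                                             ∎


  -- Filling chains over sets of colours.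

  module Filling {k : ℕ} (col : Fin N → Fin k) {A : Pred (Fin N) 0ℓ} (A? : Decidable A)
    (hall : ∀ I → HallSet _~_ col A I ∣ I ∣) where

    S : Subset k → Pred (Fin N) 0ℓ
    S I v = A v × I ∋ col v

    -- For all `I` together: `c` is a chain map from the simplex on the colours to the independence
    -- complex, and its value at `I` uses only colours in `I`. It is built by the method of acyclic
    -- carriers.
    Carried : (Subset k → Chain N) → Subset k → Set
    Carried c I = On (S I) (suc ∣ I ∣) (c I) × (∀ σ → ∂ (c I) σ ≡ δ (λ J → c J σ) I)

    -- The prescribed boundary is a cycle because `∂` and `δ` commute and `δ` squares to zero, so
    -- `acyclic` fills it.
    fill : ∀ c I → (∀ J → ∣ J ∣ < ∣ I ∣ → Carried c J) →
      Bounds (S I) ∣ I ∣ (λ σ → δ (λ J → c J σ) I)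
    fill c I carried with hall I
    ... | M , M? , M⊆ , indep , undom =
      acyclic ∣ I ∣ (λ v → A? v ×-dec (lookup I (col v) Bool.≟ true)) M? M⊆ indep undom _ on cycle
      where
      on : On (S I) ∣ I ∣ (λ σ → δ (λ J → c J σ) I)
      on σ h with δ-support (λ J → c J σ) I h
      ... | J , p , J<I , J⊑I =
        face-mono σ (λ {v} (Av , q) → Av , J⊑I (col v) q) J<I (proj₁ (carried J J<I) σ p)
      cycle : ∀ σ → ∂ (λ τ → δ (λ J → c J τ) I) σ ≡ false
      cycle σ = begin
        ∂ (λ τ → δ (λ J → c J τ) I) σ       ≡⟨ ∂-δ c I σ ⟩
        δ (λ J → ∂ (c J) σ) I               ≡⟨ δ-cong I (λ J J<I → proj₂ (carried J J<I) σ) ⟩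
        δ (λ J → δ (λ K → c K σ) J) I       ≡⟨ δ-δ (λ K → c K σ) I ⟩
        false                               ∎
        where open ≡-Reasoning

    filling : ∀ p → ∃ λ c → (∀ I → ∣ I ∣ ≤ p → Carried c I) × c ∅ ≡ ε
    -- Only the value at the empty set counts here; the others are placeholders that later stages
    -- replace.
    filling zero = (λ _ → ε) , carried , refl
      where
      carried : ∀ I → ∣ I ∣ ≤ 0 → Carried (λ _ → ε) I
      carried I I≤0 =
          (λ σ h → s≤s (ℕ.≤-trans (ℕ.≤-reflexive (ε-size σ h)) z≤n)
                 , (λ v q → contradiction q (ε-empty σ h v))
                 , (λ u v q → contradiction q (ε-empty σ h u)))
        , (λ σ → trans (∂-ε σ) (sym (¬true⇒false (λ h →
            let _ , _ , J<I , _ = δ-support _ I h in ℕ.n≮0 (ℕ.<-≤-trans J<I I≤0)))))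
    filling (suc p) with filling p
    ... | c , carried , c∅ = c′ , carried′ , trans (agree ∅ ∅≤p) c∅
      where
      ∅≤p : ∣ ∅ {k} ∣ ≤ p
      ∅≤p = ℕ.≤-trans (ℕ.≤-reflexive (∣⊥∣≡0 k)) z≤n
      filled : ∀ I → ∣ I ∣ ≡ suc p → Bounds (S I) ∣ I ∣ (λ σ → δ (λ J → c J σ) I)
      filled I I≡ = fill c I (λ J J<I → carried J (ℕ.≤-pred (ℕ.≤-trans J<I (ℕ.≤-reflexive I≡))))
      c′ : Subset k → Chain N
      c′ I with ∣ I ∣ ℕ.≟ suc p
      ... | yes I≡ = proj₁ (filled I I≡)
      ... | no  _  = c I
      agree : ∀ I → ∣ I ∣ ≤ p → c′ I ≡ c I
      agree I I≤p with ∣ I ∣ ℕ.≟ suc p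
      ... | yes I≡ = contradiction I≤p (ℕ.<⇒≱ (ℕ.≤-reflexive (sym I≡)))
      ... | no  _  = refl
      agree-δ : ∀ I → ∣ I ∣ ≤ suc p → ∀ σ → δ (λ J → c J σ) I ≡ δ (λ J → c′ J σ) I
      agree-δ I I≤ σ = δ-cong I (λ J J<I →
        cong (λ z → z σ) (sym (agree J (ℕ.≤-pred (ℕ.≤-trans J<I I≤)))))
      carried′ : ∀ I → ∣ I ∣ ≤ suc p → Carried c′ I
      carried′ I I≤ with ∣ I ∣ ℕ.≟ suc p
      ... | yes I≡ = let _ , on , bd = filled I I≡ in on , λ σ → trans (bd σ) (agree-δ I I≤ σ)
      ... | no  I≢ = let on , bd = carried I (ℕ.≤-pred (ℕ.≤∧≢⇒< I≤ I≢)) in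
                     on , λ σ → trans (bd σ) (agree-δ I I≤ σ)

    -- Following `c` by `ρ` gives a chain map of the simplex on the colours to itself that carries
    -- every face into itself. By `diagonal` its top coefficient is odd, so some face of `c full`
    -- shows all colours.
    rainbow : ∃ λ (g : Fin k → Fin N) → (∀ i → A (g i)) × (∀ i → col (g i) ≡ i) ×
      (∀ i j → i ≢ j → ¬ g i ~ g j)
    rainbow with filling k
    ... | c , carried , c∅ = g , (λ i → proj₁ (inS i)) , col-g , indep
      where
      all-carried : ∀ I → Carried c I
      all-carried I = carried I (∣p∣≤n I)
      F : Subset k → Chain k
      F I = ρ col (c I)
      supported : ∀ I J → F I J ≡ true → J ⊑ I
      supported I J h i J∋i with ρ-support col (c I) J h
      ... | σ , p , q with q i J∋i
      ...   | v , σ∋v , refl = proj₂ (proj₁ (proj₂ (proj₁ (all-carried I) σ p)) v σ∋v)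
      compatible : ∀ I J → ∂ (F I) J ≡ δ (λ K → F K J) I
      compatible I J = begin
        ∂ (ρ col (c I)) J                      ≡⟨ ρ-∂ col (c I) J ⟨
        ρ col (∂ (c I)) J                      ≡⟨ ρ-cong col (proj₂ (all-carried I)) J ⟩
        ρ col (λ σ → δ (λ K → c K σ) I) J      ≡⟨ ρ-δ col c I J ⟩
        δ (λ K → F K J) I                      ∎
        where open ≡-Reasoning
      odd : F full full ≡ true
      odd = diagonal F supported compatible
        (trans (cong (λ z → ρ col z ∅) c∅) (ρ-ε col)) full
      face = ρ-support col (c full) full odd
      σ = proj₁ face
      isFace = proj₁ (all-carried full) σ (proj₁ (proj₂ face))
      pick : ∀ i → ∃ λ v → σ ∋ v × col v ≡ i
      pick i = proj₂ (proj₂ face) i (lookup-replicate i true)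
      g : Fin k → Fin N
      g i = proj₁ (pick i)
      col-g : ∀ i → col (g i) ≡ i
      col-g i = proj₂ (proj₂ (pick i))
      inS : ∀ i → S full (g i)
      inS i = proj₁ (proj₂ isFace) (g i) (proj₁ (proj₂ (pick i)))
      indep : ∀ i j → i ≢ j → ¬ g i ~ g j
      indep i j i≢j = proj₂ (proj₂ isFace) (g i) (g j)
        (proj₁ (proj₂ (pick i))) (proj₁ (proj₂ (pick j)))
        (λ gi≡gj → i≢j (trans (sym (col-g i)) (trans (cong col gi≡gj) (col-g j))))

-- The Hall theorem over any finite vertex set, and its deficiency version.

rainbow : ∀ {V : Set} {N} → Fin N ↔ V → {_~_ : V → V → Set} →
  (∀ {u v} → u ~ v → v ~ u) → (∀ u v → Dec (u ~ v)) →
  (col : V → Fin k) {A : Pred V 0ℓ} → Decidable A → (∀ I → HallSet _~_ col A I ∣ I ∣) →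
  ∃ λ (g : Fin k → V) → (∀ i → A (g i)) × (∀ i → col (g i) ≡ i) × (∀ i j → i ≢ j → ¬ g i ~ g j)
rainbow {k} {V} {N} enum {_~_} ~-sym _~?_ col {A} A? hall =
  let g , p , q , r = rainbow′ in to ∘ g , p , q , r
  where
  open Inverse enum using (to; from; strictlyInverseˡ; strictlyInverseʳ)
  injective : ∀ {u v} → to u ≡ to v → u ≡ v
  injective {u} {v} eq = trans (sym (strictlyInverseʳ u)) (trans (cong from eq) (strictlyInverseʳ v))
  hall′ : ∀ I → HallSet (λ u v → to u ~ to v) (col ∘ to) (A ∘ to) I ∣ I ∣
  hall′ I with hall I
  ... | M , M? , M⊆ , indep , undom = M ∘ to , M? ∘ to , M⊆ ,
      (λ u v x y u≢v → indep (to u) (to v) x y (u≢v ∘ injective)) , undom′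
    where
    undom′ : Undominated (λ u v → to u ~ to v) (M ∘ to) ∣ I ∣
    undom′ es es< with undom (List.map to es) (subst (_< ∣ I ∣) (sym (length-map to es)) es<)
    ... | w , Mw , far = from w , subst M (sym (strictlyInverseˡ w)) Mw ,
      All-map⁻ (subst (λ v → All (λ e → ¬ e ~ v) (List.map to es)) (sym (strictlyInverseˡ w)) far)
  open IndependenceComplex (λ u v → to u ~ to v) ~-sym (λ u v → to u ~? to v) using (module Filling)
  open Filling (col ∘ to) (A? ∘ to) hall′ using () renaming (rainbow to rainbow′)

_∈?_ : (i : Fin n) (xs : List (Fin n)) → Dec (i ∈ xs)
_∈?_ = DecMembership._∈?_ Fin._≟_

covering⇒≤ : (xs : List (Fin n)) → (∀ i → i ∈ xs) → n ≤ length xs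
covering⇒≤ xs h = Fin.injective⇒≤ {f = λ i → index (h i)}
  (λ {i} {j} eq → trans (lookup-index (h i)) (trans (cong (List.lookup xs) eq) (sym (lookup-index (h j)))))

partition : {P Q : Pred (Fin k) 0ℓ} → (∀ i → P i ⊎ Q i) →
  ∃₂ λ a b → a + b ≡ k ×
    (∃ λ (f : Fin a → Fin k) → Injective _≡_ _≡_ f × (∀ i → P (f i))) ×
    (∃ λ (g : Fin b → Fin k) → Injective _≡_ _≡_ g × (∀ i → Q (g i)))
partition {zero} _ = 0 , 0 , refl , ((λ ()) , (λ { {()} }) , λ ()) , ((λ ()) , (λ { {()} }) , λ ())
partition {suc k} P⊎Q with P⊎Q zero | partition (P⊎Q ∘ suc)
... | inj₁ p | a , b , a+b≡k , (f , f-inj , Pf) , (g , g-inj , Qg) =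
  suc a , b , cong suc a+b≡k ,
  (lift 1 f , Fin.lift-injective f f-inj 1 , (λ { zero → p ; (suc i) → Pf i })) ,
  (suc ∘ g , g-inj ∘ Fin.suc-injective , Qg)
... | inj₂ q | a , b , a+b≡k , (f , f-inj , Pf) , (g , g-inj , Qg) =
  a , suc b , trans (ℕ.+-suc a b) (cong suc a+b≡k) ,
  (suc ∘ f , f-inj ∘ Fin.suc-injective , Pf) ,
  (lift 1 g , Fin.lift-injective g g-inj 1 , (λ { zero → q ; (suc i) → Qg i }))

nonempty⊎empty : (I : Subset k) → (∃ λ x → I ∋ x) ⊎ ∣ I ∣ ≡ 0
nonempty⊎empty []          = inj₂ refl
nonempty⊎empty (true ∷ I)  = inj₁ (zero , refl)
nonempty⊎empty (false ∷ I) with nonempty⊎empty I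
... | inj₁ (x , p) = inj₁ (suc x , p)
... | inj₂ p       = inj₂ p

module _ {A B C : Set} where

  lefts : List (A ⊎ (B × C)) → List A
  lefts []            = []
  lefts (inj₁ a ∷ es) = a ∷ lefts es
  lefts (inj₂ _ ∷ es) = lefts es

  rights : List (A ⊎ (B × C)) → List C
  rights []                  = []
  rights (inj₁ _ ∷ es)       = rights es
  rights (inj₂ (_ , c) ∷ es) = c ∷ rights es

  length-lefts-rights : ∀ es → length (lefts es) + length (rights es) ≡ length es
  length-lefts-rights []            = refl
  length-lefts-rights (inj₁ _ ∷ es) = cong suc (length-lefts-rights es)
  length-lefts-rights (inj₂ _ ∷ es) = trans (ℕ.+-suc _ _) (cong suc (length-lefts-rights es))

  ∈-lefts : ∀ {a es} → inj₁ a ∈ es → a ∈ lefts es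
  ∈-lefts                      (here refl) = here refl
  ∈-lefts {es = inj₁ _ ∷ _}    (there p)   = there (∈-lefts p)
  ∈-lefts {es = inj₂ _ ∷ _}    (there p)   = ∈-lefts p

  ∈-rights : ∀ {b c es} → inj₂ (b , c) ∈ es → c ∈ rights es
  ∈-rights                     (here refl) = here refl
  ∈-rights {es = inj₁ _ ∷ _}   (there p)   = ∈-rights p
  ∈-rights {es = inj₂ _ ∷ _}   (there p)   = there (∈-rights p)

-- Every colour class receives d dummy vertices, the i-th dummies of all classes being
-- pairwise adjacent; a rainbow independent set then uses at most d dummies.
partial-rainbow : ∀ {V : Set} {N} → Fin N ↔ V → {_~_ : V → V → Set} →
  (∀ {u v} → u ~ v → v ~ u) → (∀ u v → Dec (u ~ v)) →
  (col : V → Fin k) {A : Pred V 0ℓ} → Decidable A →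
  (d : ℕ) → (∀ I → HallSet _~_ col A I (∣ I ∣ ∸ d)) →
  ∃ λ (g : Fin (k ∸ d) → V) → (∀ i → A (g i)) ×
    (∀ i j → i ≢ j → col (g i) ≢ col (g j) × ¬ g i ~ g j)
partial-rainbow {k} {V} {N} enum {_~_} ~-sym _~?_ col {A} A? d hall =
  extract (rainbow enumW {_≈_} (λ {u} {v} → ≈-sym u v) _≈?_ colW AW? hallW)
  where
  W : Set
  W = V ⊎ (Fin k × Fin d)

  _≈_ : W → W → Set
  inj₁ u       ≈ inj₁ v       = u ~ v
  inj₂ (_ , i) ≈ inj₂ (_ , j) = i ≡ j
  _            ≈ _            = ⊥

  ≈-sym : ∀ u v → u ≈ v → v ≈ u
  ≈-sym (inj₁ u) (inj₁ v) = ~-sym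
  ≈-sym (inj₂ u) (inj₂ v) = sym

  _≈?_ : ∀ u v → Dec (u ≈ v)
  inj₁ u       ≈? inj₁ v       = u ~? v
  inj₂ (_ , i) ≈? inj₂ (_ , j) = i Fin.≟ j
  inj₁ _       ≈? inj₂ _       = no λ ()
  inj₂ _       ≈? inj₁ _       = no λ ()

  colW : W → Fin k
  colW = [ col , proj₁ ]′

  AW : Pred W 0ℓ
  AW = [ A , (λ _ → ⊤) ]′

  AW? : Decidable AW
  AW? (inj₁ v) = A? v
  AW? (inj₂ _) = yes tt

  hallW : ∀ I → HallSet _≈_ colW AW I ∣ I ∣
  hallW I with nonempty⊎empty I
  ... | inj₂ I≡0 = (λ _ → ⊥) , (λ _ → no λ ()) , (λ ()) , (λ _ _ ()) ,
        λ es es< → contradiction (subst (length es <_) I≡0 es<) ℕ.n≮0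
  ... | inj₁ (x₀ , I∋x₀) with hall I
  ...   | M , M? , M⊆ , indep , undom =
          MW , MW? , (λ {v} → MW⊆ v) , indepW , undomW
    where
    -- All `d` dummies of one colour are added to `M`; their indices differ, so the set stays
    -- independent.
    MW : Pred W 0ℓ
    MW = [ M , (λ (x , _) → x ≡ x₀) ]′
    MW? : Decidable MW
    MW? (inj₁ v)       = M? v
    MW? (inj₂ (x , _)) = x Fin.≟ x₀
    MW⊆ : ∀ v → MW v → AW v × I ∋ colW v
    MW⊆ (inj₁ v) p    = M⊆ p
    MW⊆ (inj₂ _) refl = tt , I∋x₀
    indepW : Independent _≈_ MW
    indepW (inj₁ u) (inj₁ v) p q u≢v = indep u v p q (u≢v ∘ cong inj₁)
    indepW (inj₁ _) (inj₂ _) _ _ _ ()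
    indepW (inj₂ _) (inj₁ _) _ _ _ ()
    indepW (inj₂ (_ , i)) (inj₂ (_ , .i)) refl refl u≢v refl = u≢v refl
    undomW : Undominated _≈_ MW ∣ I ∣
    -- A dummy whose index is missing from `es` is undominated. If none is missing, `es` has at
    -- least `d` dummies, and its fewer than `∣ I ∣ ∸ d` real vertices do not dominate `M`.
    undomW es es< with Fin.any? (λ i → ¬? (i ∈? rights es))
    ... | yes (i , i∉) = inj₂ (x₀ , i) , refl , All.tabulate (λ {e} → far e)
      where
      far : ∀ e → e ∈ es → ¬ e ≈ inj₂ (x₀ , i)
      far (inj₂ _) e∈es refl = i∉ (∈-rights e∈es)
    ... | no ¬∃ with undom (lefts es) (ℕ.m+n≤o⇒m≤o∸n (suc (length (lefts es))) bound)
      where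
      used : d ≤ length (rights es)
      used = covering⇒≤ (rights es)
        (λ i → decidable-stable (i ∈? rights es) (λ i∉ → ¬∃ (i , i∉)))
      bound : suc (length (lefts es)) + d ≤ ∣ I ∣
      bound = ℕ.≤-trans
        (s≤s (ℕ.≤-trans (ℕ.+-monoʳ-≤ (length (lefts es)) used)
                        (ℕ.≤-reflexive (length-lefts-rights es)))) es<
    ...   | w , Mw , fars = inj₁ w , Mw , All.tabulate (λ {e} → far e)
      where
      far : ∀ e → e ∈ es → ¬ e ≈ inj₁ w
      far (inj₁ e) e∈es = All.lookup fars (∈-lefts e∈es)

  enumW : Fin (N + k * d) ↔ W
  enumW = (enum ⊎-↔ Fin.*↔×) ↔-∘ Fin.+↔⊎

  extract : (∃ λ (g : Fin k → W) → (∀ i → AW (g i)) × (∀ i → colW (g i) ≡ i) ×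
      (∀ i j → i ≢ j → ¬ g i ≈ g j)) →
    ∃ λ (g : Fin (k ∸ d) → V) → (∀ i → A (g i)) ×
    (∀ i j → i ≢ j → col (g i) ≢ col (g j) × ¬ g i ~ g j)
  extract (g , Ag , col-g , indep)
    with partition {P = λ x → ∃ λ v → g x ≡ inj₁ v} {Q = λ x → ∃ λ p → g x ≡ inj₂ p} sides
    where
    sides : ∀ x → (∃ λ v → g x ≡ inj₁ v) ⊎ (∃ λ p → g x ≡ inj₂ p)
    sides x with g x
    ... | inj₁ v = inj₁ (v , refl)
    ... | inj₂ p = inj₂ (p , refl)
  ... | a , b , a+b≡k , (f , f-inj , real) , (h , h-inj , dummy) =
          vertex ∘ ι , (λ i → good (ι i)) , λ i j i≢j → apart (ι i) (ι j) (i≢j ∘ ι-inj)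
    where
    vertex : Fin a → V
    vertex i = proj₁ (real i)
    -- Chosen dummies of equal index would be adjacent, so at most `d` colours use a dummy.
    slot : Fin b → Fin d
    slot i = proj₂ (proj₁ (dummy i))
    slot-inj : Injective _≡_ _≡_ slot
    slot-inj {i} {j} eq with h i Fin.≟ h j
    ... | yes p = h-inj p
    ... | no ¬p = contradiction
      (subst₂ _≈_ (sym (proj₂ (dummy i))) (sym (proj₂ (dummy j))) eq) (indep (h i) (h j) ¬p)
    k∸d≤a : k ∸ d ≤ a
    k∸d≤a = ℕ.m≤n+o⇒m∸n≤o k d (ℕ.≤-trans (ℕ.≤-reflexive (trans (sym a+b≡k) (ℕ.+-comm a b)))
      (ℕ.+-monoˡ-≤ a (Fin.injective⇒≤ slot-inj)))
    ι : Fin (k ∸ d) → Fin a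
    ι i = inject≤ i k∸d≤a
    ι-inj : Injective _≡_ _≡_ ι
    ι-inj = Fin.inject≤-injective _ _ _ _
    good : ∀ i → A (vertex i)
    good i = subst AW (proj₂ (real i)) (Ag (f i))
    col-vertex : ∀ i → col (vertex i) ≡ f i
    col-vertex i = trans (cong colW (sym (proj₂ (real i)))) (col-g (f i))
    apart : ∀ i j → i ≢ j → col (vertex i) ≢ col (vertex j) × ¬ vertex i ~ vertex j
    apart i j i≢j =
      (λ eq → i≢j (f-inj (trans (sym (col-vertex i)) (trans eq (col-vertex j))))) ,
      (λ r → indep (f i) (f j) (i≢j ∘ f-inj)
        (subst₂ _≈_ (sym (proj₂ (real i))) (sym (proj₂ (real j))) r))

-- Weighted bipartite graphs

∑-cong : ∀ n {f g : Fin n → ℚ} → f ≗ g → ∑ n f ≡ ∑ n g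
∑-cong zero    h = refl
∑-cong (suc n) h = cong₂ ℚ._+_ (h zero) (∑-cong n (h ∘ suc))

∑-mono : ∀ n {f g : Fin n → ℚ} → (∀ i → f i ℚ.≤ g i) → ∑ n f ℚ.≤ ∑ n g
∑-mono zero    h = ℚ.≤-refl
∑-mono (suc n) h = ℚ.+-mono-≤ (h zero) (∑-mono n (h ∘ suc))

∑-0 : ∀ n → ∑ n (λ _ → 0ℚ) ≡ 0ℚ
∑-0 zero    = refl
∑-0 (suc n) = trans (ℚ.+-identityˡ _) (∑-0 n)

∑-const : ∀ n x → ∑ n (λ _ → x) ≡ n · x
∑-const zero    x = refl
∑-const (suc n) x = cong (x ℚ.+_) (∑-const n x)

∑-+ : ∀ n (f g : Fin n → ℚ) → ∑ n (λ i → f i ℚ.+ g i) ≡ ∑ n f ℚ.+ ∑ n g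
∑-+ zero    f g = refl
∑-+ (suc n) f g = trans (cong (f zero ℚ.+ g zero ℚ.+_) (∑-+ n (f ∘ suc) (g ∘ suc)))
  (+-interchange (CommutativeMonoid.commutativeSemigroup ℚ.+-0-commutativeMonoid) (f zero) (g zero) _ _)

∑-swap : ∀ m n (f : Fin m → Fin n → ℚ) →
  ∑ m (λ i → ∑ n (λ j → f i j)) ≡ ∑ n (λ j → ∑ m (λ i → f i j))
∑-swap zero    n f = sym (∑-0 n)
∑-swap (suc m) n f = trans (cong (∑ n (f zero) ℚ.+_) (∑-swap m n (f ∘ suc)))
  (sym (∑-+ n (f zero) (λ j → ∑ m (λ i → f (suc i) j))))

∑-nonneg : ∀ n {f : Fin n → ℚ} → (∀ i → 0ℚ ℚ.≤ f i) → 0ℚ ℚ.≤ ∑ n f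
∑-nonneg n h = subst (ℚ._≤ ∑ n _) (∑-0 n) (∑-mono n h)

term≤∑ : ∀ n {f : Fin n → ℚ} → (∀ i → 0ℚ ℚ.≤ f i) → ∀ i → f i ℚ.≤ ∑ n f
term≤∑ (suc n) {f} h zero    = subst (ℚ._≤ ∑ (suc n) f) (ℚ.+-identityʳ (f zero))
  (ℚ.+-monoʳ-≤ (f zero) (∑-nonneg n (h ∘ suc)))
term≤∑ (suc n) {f} h (suc i) = subst (ℚ._≤ ∑ (suc n) f) (ℚ.+-identityˡ (f (suc i)))
  (ℚ.+-mono-≤ (h zero) (term≤∑ n (h ∘ suc) i))

∑≢0 : ∀ n {f : Fin n → ℚ} → ∑ n f ≢ 0ℚ → ∃ λ i → f i ≢ 0ℚ
∑≢0 n {f} h with Fin.any? (λ i → ¬? (f i ℚ.≟ 0ℚ))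
... | yes p = p
... | no ¬p = contradiction
  (trans (∑-cong n (λ i → decidable-stable (f i ℚ.≟ 0ℚ) (λ q → ¬p (i , q)))) (∑-0 n)) h

·-mono-≤ : ∀ n {x y} → x ℚ.≤ y → n · x ℚ.≤ n · y
·-mono-≤ zero    h = ℚ.≤-refl
·-mono-≤ (suc n) h = ℚ.+-mono-≤ h (·-mono-≤ n h)

·-nonneg : ∀ n {x} → 0ℚ ℚ.≤ x → 0ℚ ℚ.≤ n · x
·-nonneg zero    h = ℚ.≤-refl
·-nonneg (suc n) h = ℚ.+-mono-≤ h (·-nonneg n h)

·-monoˡ-≤ : ∀ {m n x} → 0ℚ ℚ.≤ x → m ≤ n → m · x ℚ.≤ n · x
·-monoˡ-≤ {n = n} 0≤x z≤n   = ·-nonneg n 0≤x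
·-monoˡ-≤ {x = x} 0≤x (s≤s h) = ℚ.+-monoʳ-≤ x (·-monoˡ-≤ 0≤x h)

·-cancelʳ-≤ : ∀ m n {x} → 0ℚ ℚ.< x → m · x ℚ.≤ n · x → m ≤ n
·-cancelʳ-≤ m n {x} 0<x h with m ℕ.≤? n
... | yes m≤n = m≤n
... | no  m≰n = contradiction refl λ eq → ℚ.<-irrefl eq (ℚ.<-≤-trans lt (ℚ.≤-trans
    (·-monoˡ-≤ (ℚ.<⇒≤ 0<x) (ℕ.≰⇒> m≰n)) h))
  where
  lt : n · x ℚ.< suc n · x
  lt = subst (ℚ._< suc n · x) (ℚ.+-identityˡ (n · x)) (ℚ.+-monoˡ-< (n · x) 0<x)

·-cancelˡ : ∀ n .{{_ : NonZero n}} {x y} → n · x ≡ n · y → x ≡ y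
·-cancelˡ (suc n) {x} {y} eq with ℚ.<-cmp x y
... | tri< x<y _ _ = contradiction (ℚ.+-mono-<-≤ x<y (·-mono-≤ n (ℚ.<⇒≤ x<y))) (ℚ.<-irrefl eq)
... | tri≈ _ x≡y _ = x≡y
... | tri> _ _ y<x = contradiction (ℚ.+-mono-<-≤ y<x (·-mono-≤ n (ℚ.<⇒≤ y<x))) (ℚ.<-irrefl (sym eq))

mask : Bool → ℚ → ℚ
mask true  x = x
mask false x = 0ℚ

mask-nonneg : ∀ b {x} → 0ℚ ℚ.≤ x → 0ℚ ℚ.≤ mask b x
mask-nonneg true  h = h
mask-nonneg false h = ℚ.≤-refl

mask-≤ : ∀ b {x} → 0ℚ ℚ.≤ x → mask b x ℚ.≤ x
mask-≤ true  h = ℚ.≤-refl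
mask-≤ false h = h

∑-mask : ∀ n b (f : Fin n → ℚ) → ∑ n (λ i → mask b (f i)) ≡ mask b (∑ n f)
∑-mask n true  f = refl
∑-mask n false f = ∑-0 n

∑-masked-const : (I : Subset n) → ∀ x → ∑ n (λ i → mask (lookup I i) x) ≡ ∣ I ∣ · x
∑-masked-const []          x = refl
∑-masked-const (true ∷ I)  x = cong (x ℚ.+_) (∑-masked-const I x)
∑-masked-const (false ∷ I) x = trans (ℚ.+-identityˡ _) (∑-masked-const I x)

mask-mono : ∀ b {x y} → x ℚ.≤ y → mask b x ℚ.≤ mask b y
mask-mono true  h = h
mask-mono false h = ℚ.≤-refl

-- Weak duality: every nonzero entry lies on a line of the cover, and each line sums to at most `x`.
total≤cover : ∀ {b c} (w : Fin b → Fin c → ℚ) {x} → (∀ i j → 0ℚ ℚ.≤ w i j) →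
  (∀ i → ∑ c (w i) ℚ.≤ x) → (∀ j → ∑ b (λ i → w i j) ℚ.≤ x) →
  (I : Subset b) (J : Subset c) → (∀ i j → I ∋ i ⊎ J ∋ j ⊎ w i j ≡ 0ℚ) →
  ∑ b (λ i → ∑ c (w i)) ℚ.≤ (∣ I ∣ + ∣ J ∣) · x
total≤cover {b} {c} w {x} nonneg rows cols I J covered = begin
  ∑ b (λ i → ∑ c (w i))
    ≤⟨ ∑-mono b (λ i → ∑-mono c (λ j → pointwise i j)) ⟩
  ∑ b (λ i → ∑ c (λ j → mask (lookup I i) (w i j) ℚ.+ mask (lookup J j) (w i j)))
    ≡⟨ ∑-cong b (λ i → ∑-+ c _ _) ⟩
  ∑ b (λ i → ∑ c (λ j → mask (lookup I i) (w i j)) ℚ.+ ∑ c (λ j → mask (lookup J j) (w i j)))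
    ≡⟨ ∑-+ b _ _ ⟩
  ∑ b (λ i → ∑ c (λ j → mask (lookup I i) (w i j))) ℚ.+ ∑ b (λ i → ∑ c (λ j → mask (lookup J j) (w i j)))
    ≡⟨ cong₂ ℚ._+_ (∑-cong b (λ i → ∑-mask c (lookup I i) (w i)))
        (trans (∑-swap b c _) (∑-cong c (λ j → ∑-mask b (lookup J j) (λ i → w i j)))) ⟩
  ∑ b (λ i → mask (lookup I i) (∑ c (w i))) ℚ.+ ∑ c (λ j → mask (lookup J j) (∑ b (λ i → w i j)))
    ≤⟨ ℚ.+-mono-≤ (∑-mono b (λ i → mask-mono (lookup I i) (rows i)))
                  (∑-mono c (λ j → mask-mono (lookup J j) (cols j))) ⟩
  ∑ b (λ i → mask (lookup I i) x) ℚ.+ ∑ c (λ j → mask (lookup J j) x)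
    ≡⟨ cong₂ ℚ._+_ (∑-masked-const I x) (∑-masked-const J x) ⟩
  ∣ I ∣ · x ℚ.+ ∣ J ∣ · x
    ≡⟨ ×-homo-+ x ∣ I ∣ ∣ J ∣ ⟨
  (∣ I ∣ + ∣ J ∣) · x ∎
  where
  open ℚ.≤-Reasoning
  pointwise : ∀ i j → w i j ℚ.≤ mask (lookup I i) (w i j) ℚ.+ mask (lookup J j) (w i j)
  pointwise i j with covered i j
  ... | inj₁ I∋i rewrite I∋i = subst (ℚ._≤ w i j ℚ.+ mask (lookup J j) (w i j)) (ℚ.+-identityʳ (w i j))
        (ℚ.+-monoʳ-≤ (w i j) (mask-nonneg (lookup J j) (nonneg i j)))
  ... | inj₂ (inj₁ J∋j) rewrite J∋j = subst (ℚ._≤ mask (lookup I i) (w i j) ℚ.+ w i j) (ℚ.+-identityˡ (w i j))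
        (ℚ.+-monoˡ-≤ (w i j) (mask-nonneg (lookup I i) (nonneg i j)))
  ... | inj₂ (inj₂ w≡0) = subst (ℚ._≤ mask (lookup I i) (w i j) ℚ.+ mask (lookup J j) (w i j)) (sym w≡0)
        (ℚ.+-mono-≤ (mask-nonneg (lookup I i) (nonneg i j)) (mask-nonneg (lookup J j) (nonneg i j)))

fromList : List (Fin n) → Subset n
fromList []       = ∅
fromList (x ∷ xs) = fromList xs [ x ]≔ true

∣insert∣≤ : (σ : Subset n) (e : Fin n) → ∣ σ [ e ]≔ true ∣ ≤ suc ∣ σ ∣
∣insert∣≤ (true ∷ σ)  zero    = ℕ.n≤1+n _
∣insert∣≤ (false ∷ σ) zero    = ℕ.≤-refl
∣insert∣≤ (true ∷ σ)  (suc e) = s≤s (∣insert∣≤ σ e)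
∣insert∣≤ (false ∷ σ) (suc e) = ∣insert∣≤ σ e

∣fromList∣≤ : (xs : List (Fin n)) → ∣ fromList xs ∣ ≤ length xs
∣fromList∣≤ {n} [] = ℕ.≤-reflexive (∣⊥∣≡0 n)
∣fromList∣≤ (x ∷ xs) = ℕ.≤-trans (∣insert∣≤ (fromList xs) x) (s≤s (∣fromList∣≤ xs))

∈⇒fromList∋ : ∀ {i} (xs : List (Fin n)) → i ∈ xs → fromList xs ∋ i
∈⇒fromList∋ (x ∷ xs) (here refl) = lookup∘update x (fromList xs) true
∈⇒fromList∋ {i = i} (x ∷ xs) (there p) with i Fin.≟ x
... | yes refl = lookup∘update x (fromList xs) true
... | no  i≢x  = trans (lookup∘update′ i≢x (fromList xs) true) (∈⇒fromList∋ xs p)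

<∸⇒+< : ∀ {m n o} → m < n ∸ o → m + o < n
<∸⇒+< {m} {n} {o} m<n∸o = ℕ.m≤o∸n⇒m+n≤o (suc m)
  (ℕ.<⇒≤ (ℕ.m∸n≢0⇒n<m (λ eq → ℕ.n≮0 (subst (m <_) eq m<n∸o)))) m<n∸o

-- For each column met by the rows I, one entry of it is put into the independent set; the
-- set is undominated because a small dominating set would give a small vertex cover.
weighted-matching : ∀ {b c} (w : Fin b → Fin c → ℚ) {x} → (∀ i j → 0ℚ ℚ.≤ w i j) →
  (∀ i → ∑ c (w i) ℚ.≤ x) → (∀ j → ∑ b (λ i → w i j) ℚ.≤ x) →
  ∀ q → q ≤ b → (∀ a → ∑ b (λ i → ∑ c (w i)) ℚ.≤ a · x → q ≤ a) →
  ∃ λ (g : Fin q → Fin b × Fin c) → (∀ i → w (proj₁ (g i)) (proj₂ (g i)) ≢ 0ℚ) ×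
    (∀ i j → i ≢ j → proj₁ (g i) ≢ proj₁ (g j) × proj₂ (g i) ≢ proj₂ (g j))
weighted-matching {b} {c} w {x} nonneg rows cols q q≤b heavy =
  -- Of the `b` rows, `b ∸ q` are given up as the deficiency, which leaves `q`.
  subst (λ r → ∃ λ (g : Fin r → Fin b × Fin c) → (∀ i → w (proj₁ (g i)) (proj₂ (g i)) ≢ 0ℚ) ×
      (∀ i j → i ≢ j → proj₁ (g i) ≢ proj₁ (g j) × proj₂ (g i) ≢ proj₂ (g j)))
    (ℕ.m∸[m∸n]≡n q≤b)
    (partial-rainbow Fin.*↔× sym (λ u v → proj₂ u Fin.≟ proj₂ v) proj₁
      (λ (i , j) → ¬? (w i j ℚ.≟ 0ℚ)) (b ∸ q) hall)
  where
  hall : ∀ I → HallSet (λ u v → proj₂ u ≡ proj₂ v) proj₁ (λ (i , j) → w i j ≢ 0ℚ) I (∣ I ∣ ∸ (b ∸ q))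
  hall I = M , M? , M⊆ , indep , undom
    where
    hit? : ∀ j → Dec (∃ λ i → I ∋ i × w i j ≢ 0ℚ)
    hit? j = Fin.any? (λ i → (lookup I i Bool.≟ true) ×-dec ¬? (w i j ℚ.≟ 0ℚ))
    -- A function of the decision, so that column `j` contributes the one row found by `hit? j`.
    Chosen : ∀ {j} → Dec (∃ λ i → I ∋ i × w i j ≢ 0ℚ) → Pred (Fin b) 0ℓ
    Chosen (yes (i′ , _)) i = i ≡ i′
    Chosen (no _)         i = ⊥
    M : Pred (Fin b × Fin c) 0ℓ
    M (i , j) = Chosen (hit? j) i
    M? : Decidable M
    M? (i , j) with hit? j
    ... | yes (i′ , _) = i Fin.≟ i′
    ... | no _         = no λ ()
    M⊆ : ∀ {v} → M v → w (proj₁ v) (proj₂ v) ≢ 0ℚ × I ∋ proj₁ v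
    M⊆ {i , j} m with hit? j
    M⊆ {i , j} refl | yes (_ , I∋i , w≢0) = w≢0 , I∋i
    unique : ∀ {j} (d : Dec (∃ λ i → I ∋ i × w i j ≢ 0ℚ)) {i i′} → Chosen d i → Chosen d i′ → i ≡ i′
    unique (yes _) refl refl = refl
    indep : Independent (λ u v → proj₂ u ≡ proj₂ v) M
    indep (i , j) (i′ , .j) m m′ u≢v refl = u≢v (cong (_, j) (unique (hit? j) m m′))
    undom : Undominated (λ u v → proj₂ u ≡ proj₂ v) M (∣ I ∣ ∸ (b ∸ q))
    undom es es< with Fin.any? (λ j → ¬? (j ∈? List.map proj₂ es) ×-dec hit? j)
    ... | yes (j , j∉ , hit) = choose (hit? j) refl
      where
      choose : ∀ d → hit? j ≡ d → ∃ λ v → M v × All (λ e → ¬ proj₂ e ≡ proj₂ v) es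
      choose (yes (i , _)) eq = (i , j) , subst (λ d → Chosen d i) (sym eq) refl ,
        All.tabulate (λ e∈es e≡j → j∉ (subst (_∈ List.map proj₂ es) e≡j (∈-map⁺ proj₂ e∈es)))
      choose (no ¬hit)     _  = contradiction hit ¬hit
    ... | no ¬∃ = ⊥-elim (ℕ.<-irrefl refl too-small)
      where
      js = List.map proj₂ es
      -- As `es` meets every column hit by `I`, the rows outside `I` and the columns of `es` form a
      -- vertex cover.
      covered : ∀ i j → ∁ I ∋ i ⊎ fromList js ∋ j ⊎ w i j ≡ 0ℚ
      covered i j with lookup I i in eq | j ∈? js | w i j ℚ.≟ 0ℚ
      ... | false | _      | _       = inj₁ (trans (lookup-map i Bool.not I) (cong Bool.not eq))
      ... | true  | yes j∈ | _       = inj₂ (inj₁ (∈⇒fromList∋ js j∈))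
      ... | true  | no _   | yes w≡0 = inj₂ (inj₂ w≡0)
      ... | true  | no j∉  | no w≢0  = contradiction (j , j∉ , i , eq , w≢0) ¬∃
      open ℕ.≤-Reasoning
      q≤ : q ≤ (b ∸ ∣ I ∣) + length es
      q≤ = begin
        q                               ≤⟨ heavy _ (total≤cover w nonneg rows cols (∁ I) (fromList js) covered) ⟩
        ∣ ∁ I ∣ + ∣ fromList js ∣     ≡⟨ cong (_+ ∣ fromList js ∣) (∣∁p∣≡n∸∣p∣ I) ⟩
        (b ∸ ∣ I ∣) + ∣ fromList js ∣ ≤⟨ ℕ.+-monoʳ-≤ (b ∸ ∣ I ∣) (∣fromList∣≤ js) ⟩
        (b ∸ ∣ I ∣) + length js       ≡⟨ cong (b ∸ ∣ I ∣ +_) (length-map proj₂ es) ⟩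
        (b ∸ ∣ I ∣) + length es       ∎
      rearrange : ∀ l m n → l + (m + n) ≡ m + (n + l)
      rearrange = solve-∀
      -- By `heavy` the cover has at least `q` lines, which contradicts
      -- `length es < ∣ I ∣ ∸ (b ∸ q)`.
      too-small : b < b
      too-small = begin-strict
        b                                             ≡⟨ ℕ.m∸n+n≡m q≤b ⟨
        (b ∸ q) + q                                 ≤⟨ ℕ.+-monoʳ-≤ (b ∸ q) q≤ ⟩
        (b ∸ q) + ((b ∸ ∣ I ∣) + length es)       ≡⟨ rearrange (b ∸ q) (b ∸ ∣ I ∣) (length es) ⟩
        (b ∸ ∣ I ∣) + (length es + (b ∸ q))       <⟨ ℕ.+-monoʳ-< (b ∸ ∣ I ∣) (<∸⇒+< es<) ⟩
        (b ∸ ∣ I ∣) + ∣ I ∣                         ≡⟨ ℕ.m∸n+n≡m (∣p∣≤n I) ⟩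
        b                                             ∎

-- Matchings in tripartite hypergraphs.

slack-identity : ∀ s d r e →
  (suc s + d) * (suc (s + s) + (r + r) + e) ≡
  (suc s + r + d) * (s + s) +
    suc (s + d + (suc s + d) * e + (r + r) * suc d)
slack-identity = solve-∀

-- Since s + 1 ≤ m, the ratio (s + 1 + d) / (m + d) is at least (s + 1) / m. Hence a ≥ (2m - 1)(s +
-- 1) / m = 2s + 2 - (s + 1) / m ≥ 2s + 1.
counting : ∀ s d {m n a} → suc s ≤ m → m + m ≤ suc n →
  (suc s + d) * n ≤ (m + d) * a → suc (s + s) ≤ a
counting s d {m} {n} {a} s<m 2m≤1+n h with suc (s + s) ℕ.≤? a
... | yes p = p
... | no ¬p with ℕ.m≤n⇒∃[o]m+o≡n s<m
...   | r , refl with ℕ.m≤n⇒∃[o]m+o≡n 2m≤1+n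
...     | e , eq = ⊥-elim (ℕ.<-irrefl refl (begin-strict
    (suc s + r + d) * (s + s)
      <⟨ ℕ.m<m+n _ z<s ⟩
    -- With m = s + 1 + r and n = 2s + 1 + 2r + e, the excess over the case a = 2s is a polynomial
    -- with natural coefficients and constant term 1.
    _ ≡⟨ slack-identity s d r e ⟨
    (suc s + d) * (suc (s + s) + (r + r) + e)
      ≡⟨ cong ((suc s + d) *_) (ℕ.suc-injective (trans (sym (double s r e)) eq)) ⟩
    (suc s + d) * n                    ≤⟨ h ⟩
    (suc s + r + d) * a
      ≤⟨ ℕ.*-monoʳ-≤ (suc s + r + d) (ℕ.≤-pred (ℕ.≰⇒> ¬p)) ⟩
    (suc s + r + d) * (s + s)      ∎))
  where
  open ℕ.≤-Reasoning
  double : ∀ s r e → (suc s + r) + (suc s + r) + e ≡ suc (suc (s + s) + (r + r) + e)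
  double = solve-∀

-- By injectivity each entry of `ys` or `zs` rules out at most one index, so ruling out all of them
-- would inject `Fin q` into the positions of the two lists.
avoiding : ∀ {q b c} (y : Fin q → Fin b) (z : Fin q → Fin c) →
  Injective _≡_ _≡_ y → Injective _≡_ _≡_ z → (ys : List (Fin b)) (zs : List (Fin c)) →
  length ys + length zs < q → ∃ λ j → ¬ y j ∈ ys × ¬ z j ∈ zs
avoiding {q} y z y-inj z-inj ys zs short
  with Fin.any? (λ j → ¬? (y j ∈? ys) ×-dec ¬? (z j ∈? zs))
... | yes p = p
... | no ¬p = contradiction (Fin.injective⇒≤ {f = Fin.join _ _ ∘ slot ∘ hit} slot-inj) (ℕ.<⇒≱ short)
  where
  hit : ∀ j → y j ∈ ys ⊎ z j ∈ zs
  hit j with y j ∈? ys | z j ∈? zs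
  ... | yes p | _     = inj₁ p
  ... | no _  | yes p = inj₂ p
  ... | no p  | no p′ = contradiction (j , p , p′) ¬p
  slot : ∀ {j} → y j ∈ ys ⊎ z j ∈ zs → Fin (length ys) ⊎ Fin (length zs)
  slot = Sum.map index index
  same : ∀ {A : Set} {u v : A} {xs} (p : u ∈ xs) (p′ : v ∈ xs) → index p ≡ index p′ → u ≡ v
  same {xs = xs} p p′ eq = trans (lookup-index p) (trans (cong (List.lookup xs) eq) (sym (lookup-index p′)))
  slot-same : ∀ {i j} (p : y i ∈ ys ⊎ z i ∈ zs) (p′ : y j ∈ ys ⊎ z j ∈ zs) → slot p ≡ slot p′ → i ≡ j
  slot-same (inj₁ p) (inj₁ p′) eq = y-inj (same p p′ (inj₁-injective eq))
  slot-same (inj₂ p) (inj₂ p′) eq = z-inj (same p p′ (inj₂-injective eq))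
  slot-inj : Injective _≡_ _≡_ (Fin.join (length ys) (length zs) ∘ slot ∘ hit)
  slot-inj {i} {j} eq = slot-same (hit i) (hit j)
    (trans (sym (Fin.splitAt-join _ _ (slot (hit i))))
      (trans (cong (Fin.splitAt (length ys)) eq) (Fin.splitAt-join _ _ (slot (hit j)))))

-- The Hall theorem with deficiency `k ∸ m`: for s + 1 + d colours the independent set must
-- withstand s edges. These meet at most 2s edges of a matching, so one of size 2s + 1 in the link
-- suffices; `counting` provides it.
matching : ∀ {k n} m → m ≤ k → m + m ≤ suc n →
  (H : Hypergraph3 k n n) → FractionallyBalanced H → HasMatchingOfSize H m
matching {k} {n} m m≤k 2m≤1+n H
    (f , (nonneg , vanishing) , (bal₁ , bal₂ , bal₃) , x₀ , y₀ , z₀ , f≢0) =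
  let g , inH , apart = subst Partial (ℕ.m∸[m∸n]≡n m≤k)
        (partial-rainbow enum (λ { (inj₁ p) → inj₁ (sym p) ; (inj₂ p) → inj₂ (sym p) })
          (λ (_ , y , z) (_ , y′ , z′) → (y Fin.≟ y′) ⊎-dec (z Fin.≟ z′)) proj₁
          (λ (x , y , z) → H x y z Bool.≟ true) d hall)
  in g , inH , λ i j i≢j → let p , q = apart i j i≢j in p , q ∘ inj₁ , q ∘ inj₂
  where
  d : ℕ
  d = k ∸ m

  Edge : Set
  Edge = Fin k × Fin n × Fin n

  _~_ : Edge → Edge → Set
  (_ , y , z) ~ (_ , y′ , z′) = y ≡ y′ ⊎ z ≡ z′

  Partial : ℕ → Set
  Partial r = ∃ λ (g : Fin r → Edge) → (∀ i → H ∋₃ g i) ×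
    (∀ i j → i ≢ j → proj₁ (g i) ≢ proj₁ (g j) × ¬ g i ~ g j)

  enum : Fin (k * (n * n)) ↔ Edge
  enum = (↔-id (Fin k) ×-↔ Fin.*↔×) ↔-∘ Fin.*↔×

  D₁ D₂ : ℚ
  D₁ = deg₁ f x₀
  D₂ = deg₂ f y₀

  total₁ : ∑ k (deg₁ f) ≡ k · D₁
  total₁ = trans (∑-cong k (λ x → bal₁ x x₀)) (∑-const k D₁)

  total₂ : ∑ k (deg₁ f) ≡ n · D₂
  total₂ = trans (∑-swap k n (λ x y → ∑ n (f x y)))
    (trans (∑-cong n (λ y → bal₂ y y₀)) (∑-const n D₂))

  total₃ : ∑ k (deg₁ f) ≡ n · deg₃ f z₀
  total₃ = trans (∑-cong k (λ x → ∑-swap n n (f x)))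
    (trans (∑-swap k n (λ x z → ∑ n (λ y → f x y z)))
      (trans (∑-cong n (λ z → bal₃ z z₀)) (∑-const n (deg₃ f z₀))))

  -- V₂ and V₃ both have `n` vertices and carry the same total weight.
  deg₃≡D₂ : ∀ z → deg₃ f z ≡ D₂
  deg₃≡D₂ z = trans (bal₃ z z₀) (·-cancelˡ n {{Fin.nonZeroIndex y₀}} (trans (sym total₃) total₂))

  D₂>0 : 0ℚ ℚ.< D₂
  D₂>0 = ℚ.<-≤-trans (ℚ.≰⇒> (λ f≤0 → f≢0 (ℚ.≤-antisym f≤0 (nonneg x₀ y₀ z₀))))
    (ℚ.≤-trans (term≤∑ n (nonneg x₀ y₀) z₀)
      (term≤∑ k (λ x → ∑-nonneg n (nonneg x y₀)) x₀))

  -- The weighted bipartite link of `I`. Dropping the other colours only lowers line sums, which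
  -- thus stay at most `D₂`, while the total is exactly `∣ I ∣ · D₁`.
  module Link (I : Subset k) where
    w : Fin n → Fin n → ℚ
    w y z = ∑ k (λ x → mask (lookup I x) (f x y z))

    w-nonneg : ∀ y z → 0ℚ ℚ.≤ w y z
    w-nonneg y z = ∑-nonneg k (λ x → mask-nonneg (lookup I x) (nonneg x y z))

    w≤ : ∀ y z → w y z ℚ.≤ ∑ k (λ x → f x y z)
    w≤ y z = ∑-mono k (λ x → mask-≤ (lookup I x) (nonneg x y z))

    rows : ∀ y → ∑ n (w y) ℚ.≤ D₂
    rows y = ℚ.≤-trans (∑-mono n (w≤ y))
      (ℚ.≤-reflexive (trans (∑-swap n k (λ z x → f x y z)) (bal₂ y y₀)))

    cols : ∀ z → ∑ n (λ y → w y z) ℚ.≤ D₂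
    cols z = ℚ.≤-trans (∑-mono n (λ y → w≤ y z))
      (ℚ.≤-reflexive (trans (∑-swap n k (λ y x → f x y z)) (deg₃≡D₂ z)))

    total : ∑ n (λ y → ∑ n (w y)) ≡ ∣ I ∣ · D₁
    total = begin
      ∑ n (λ y → ∑ n (λ z → ∑ k (λ x → mask (lookup I x) (f x y z))))
        ≡⟨ ∑-cong n (λ y → ∑-swap n k (λ z x → mask (lookup I x) (f x y z))) ⟩
      ∑ n (λ y → ∑ k (λ x → ∑ n (λ z → mask (lookup I x) (f x y z))))
        ≡⟨ ∑-swap n k (λ y x → ∑ n (λ z → mask (lookup I x) (f x y z))) ⟩
      ∑ k (λ x → ∑ n (λ y → ∑ n (λ z → mask (lookup I x) (f x y z))))
        ≡⟨ ∑-cong k (λ x → trans (∑-cong n (λ y → ∑-mask n (lookup I x) (f x y)))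
                                 (∑-mask n (lookup I x) (λ y → ∑ n (f x y)))) ⟩
      ∑ k (λ x → mask (lookup I x) (deg₁ f x))
        ≡⟨ ∑-cong k (λ x → cong (mask (lookup I x)) (bal₁ x x₀)) ⟩
      ∑ k (λ x → mask (lookup I x) D₁)
        ≡⟨ ∑-masked-const I D₁ ⟩
      ∣ I ∣ · D₁ ∎
      where open ≡-Reasoning

    -- Multiplying by `k` avoids division: k D₁ = n D₂ turns the hypothesis into a comparison of two
    -- multiples of `D₂`.
    heavy : ∀ a → ∑ n (λ y → ∑ n (w y)) ℚ.≤ a · D₂ → ∣ I ∣ * n ≤ k * a
    heavy a h = ·-cancelʳ-≤ (∣ I ∣ * n) (k * a) D₂>0 (begin
      (∣ I ∣ * n) · D₂     ≡⟨ ×-assocˡ D₂ ∣ I ∣ n ⟨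
      ∣ I ∣ · (n · D₂)       ≡⟨ cong (∣ I ∣ ·_) (trans (sym total₂) total₁) ⟩
      ∣ I ∣ · (k · D₁)       ≡⟨ ×-assocˡ D₁ ∣ I ∣ k ⟩
      (∣ I ∣ * k) · D₁     ≡⟨ cong (_· D₁) (ℕ.*-comm ∣ I ∣ k) ⟩
      (k * ∣ I ∣) · D₁     ≡⟨ ×-assocˡ D₁ k ∣ I ∣ ⟨
      k · (∣ I ∣ · D₁)       ≡⟨ cong (k ·_) total ⟨
      k · ∑ n (λ y → ∑ n (w y))   ≤⟨ ·-mono-≤ k h ⟩
      k · (a · D₂)           ≡⟨ ×-assocˡ D₂ k a ⟩
      (k * a) · D₂         ∎)
      where open ℚ.≤-Reasoning

    edge : ∀ y z → w y z ≢ 0ℚ → ∃ λ x → I ∋ x × H x y z ≡ true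
    edge y z w≢0 with ∑≢0 k w≢0
    ... | x , p with lookup I x in I∋x | H x y z in Hxyz
    ...   | true  | true  = x , I∋x , Hxyz
    ...   | true  | false = contradiction (vanishing x y z Hxyz) p
    ...   | false | _     = contradiction refl p

  hall : ∀ I → HallSet _~_ proj₁ (H ∋₃_) I (∣ I ∣ ∸ d)
  hall I with ∣ I ∣ ∸ d in eq
  ... | zero  = (λ _ → ⊥) , (λ _ → no λ ()) , (λ ()) , (λ _ _ ()) , λ _ ()
  ... | suc s = fromMatching (weighted-matching w w-nonneg rows cols (suc (s + s)) q≤n
                  (λ a h → counting s d s<m 2m≤1+n (subst₂ (λ u v → u * n ≤ v * a) I≡ k≡ (heavy a h))))
    where
    open Link I
    I≡ : ∣ I ∣ ≡ suc s + d
    I≡ = trans (sym (ℕ.m∸n+n≡m {n = d} (ℕ.<⇒≤ (ℕ.m∸n≢0⇒n<m (λ I∸d≡0 → contradiction (trans (sym eq) I∸d≡0) λ ())))))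
               (cong (_+ d) eq)
    k≡ : k ≡ m + d
    k≡ = sym (ℕ.m+[n∸m]≡n m≤k)
    s<m : suc s ≤ m
    s<m = ℕ.+-cancelʳ-≤ d (suc s) m (subst₂ _≤_ I≡ k≡ (∣p∣≤n I))
    -- 2s + 2 ≤ 2m ≤ n + 1.
    q≤n : suc (s + s) ≤ n
    q≤n = ℕ.≤-pred (ℕ.≤-trans (ℕ.≤-reflexive (cong suc (sym (ℕ.+-suc s s))))
      (ℕ.≤-trans (ℕ.+-mono-≤ s<m s<m) 2m≤1+n))

    fromMatching : (∃ λ (g : Fin (suc (s + s)) → Fin n × Fin n) →
        (∀ i → w (proj₁ (g i)) (proj₂ (g i)) ≢ 0ℚ) ×
        (∀ i j → i ≢ j → proj₁ (g i) ≢ proj₁ (g j) × proj₂ (g i) ≢ proj₂ (g j))) →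
      HallSet _~_ proj₁ (H ∋₃_) I (suc s)
    fromMatching (g , positive , apart) = M , M? , (λ { (j , refl) → M⊆ j }) , indep , undom
      where
      y z : Fin (suc (s + s)) → Fin n
      y j = proj₁ (g j)
      z j = proj₂ (g j)
      -- Each link edge is lifted to an edge of `H` with a colour in `I`. Colours may repeat, as
      -- `_~_` ignores them.
      t : Fin (suc (s + s)) → Edge
      t j = proj₁ (edge (y j) (z j) (positive j)) , g j
      M : Pred Edge 0ℓ
      M v = ∃ λ j → v ≡ t j
      M? : Decidable M
      M? v = Fin.any? (λ j → ≡-dec Fin._≟_ (≡-dec Fin._≟_ Fin._≟_) v (t j))
      M⊆ : ∀ j → H ∋₃ t j × I ∋ proj₁ (t j)
      M⊆ j = let _ , p , q = edge (y j) (z j) (positive j) in q , p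
      indep : Independent _~_ M
      indep _ _ (i , refl) (j , refl) ti≢tj with apart i j (ti≢tj ∘ cong t)
      ... | y≢ , z≢ = λ { (inj₁ p) → y≢ p ; (inj₂ p) → z≢ p }
      y-inj : Injective _≡_ _≡_ y
      y-inj {i} {j} p = decidable-stable (i Fin.≟ j) (λ i≢j → proj₁ (apart i j i≢j) p)
      z-inj : Injective _≡_ _≡_ z
      z-inj {i} {j} p = decidable-stable (i Fin.≟ j) (λ i≢j → proj₂ (apart i j i≢j) p)
      -- Every edge meets at most two edges of the matching.
      undom : Undominated _~_ M (suc s)
      undom es (s≤s es≤s)
        with avoiding y z y-inj z-inj (List.map (proj₁ ∘ proj₂) es) (List.map (proj₂ ∘ proj₂) es)
               (s≤s (subst₂ (λ u v → u + v ≤ s + s)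
                 (sym (length-map _ es)) (sym (length-map _ es)) (ℕ.+-mono-≤ es≤s es≤s)))
      ... | j , y∉ , z∉ = t j , (j , refl) , All.tabulate λ where
        e∈es (inj₁ p) → y∉ (subst (_∈ _) p (∈-map⁺ (proj₁ ∘ proj₂) e∈es))
        e∈es (inj₂ p) → z∉ (subst (_∈ _) p (∈-map⁺ (proj₂ ∘ proj₂) e∈es))

theorem4p8 : (k n : ℕ) → 1 ≤ k → k ≤ n →
    (H : Hypergraph3 k n n) → FractionallyBalanced H →
    HasMatchingOfSize H (k ⊓ ⌈ n /2⌉)
theorem4p8 k n _ _ = matching (k ⊓ ⌈ n /2⌉) (ℕ.m⊓n≤m k ⌈ n /2⌉) (begin
  (k ⊓ ⌈ n /2⌉) + (k ⊓ ⌈ n /2⌉)   ≤⟨ ℕ.+-mono-≤ (ℕ.m⊓n≤n k ⌈ n /2⌉) (ℕ.m⊓n≤n k ⌈ n /2⌉) ⟩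
  -- `⌈ n /2⌉` unfolds to `⌊ suc n /2⌋`, so its double is at most n + 1.
  ⌊ suc n /2⌋ + ⌊ suc n /2⌋       ≤⟨ ℕ.+-monoʳ-≤ ⌊ suc n /2⌋ (ℕ.⌊n/2⌋≤⌈n/2⌉ (suc n)) ⟩
  ⌊ suc n /2⌋ + ⌈ suc n /2⌉       ≡⟨ ℕ.⌊n/2⌋+⌈n/2⌉≡n (suc n) ⟩
  suc n                             ∎)
  where open ℕ.≤-Reasoning
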